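{- For every integer $n\ge1$, $$OD_n\sim HOD_{n-1}\ \dot{\cup}\ HOD_{n-1}\ \dot{\cup}\ P_1\ \dot{\cup}\ Q_n\ \dot{\cup}\ Q'_n.$$
   Context: The adjacency matrix of a weighted graph has rows and columns indexed by the vertices, its $(u,v)$-entry being the weight of the edge between $u$ and $v$ if there is one, and $0$ otherwise (a loop of weight $c$ at $u$ contributes the diagonal entry $c$); unweighted graphs have all weights $1$. Two graphs are called similar, written $G_1\sim G_2$, if their adjacency matrices are similar matrices. $\dot\cup$ denotes disjoint union. The odd Aztec diamond $OD_n$ is the graph whose vertices are the black unit squares of a $(2n+1)\times(2n+1)$ chessboard with black corners, two vertices being adjacent if the corresponding squares share a corner. The halved odd Aztec diamond $HOD_n$ is the subgraph of $OD_n$ induced by the black unit squares on or above a diagonal of the $(2n+1)\times(2n+1)$ chessboard ($HOD_0$ is a single vertex). $P_n$ is the path on $n$ vertices (edge weights $1$); in particular $P_1$ is a single vertex with no edges. $Q_n$ is obtained from $P_n$ by including a loop of weight $2$ at each vertex; $Q'_n$ is obtained from $P_n$ by including a loop of weight $-2$ at each vertex. -}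

module Defs where

open import Algebra.Bundles using (CommutativeRing)
open import Data.Bool.Base using (if_then_else_)
open import Data.Fin.Base using (Fin; toℕ)
import Data.Fin.Base as Fin
import Data.Fin.Properties as Fin
open import Data.Integer.Base using (+_; -[1+_])
open import Data.List.Base
  using (List; length; lookup; map; _++_; filter; allFin; cartesianProduct)
open import Data.List.Membership.Propositional.Properties using (∈-map⁻)
open import Data.List.Relation.Binary.Disjoint.Propositional using (Disjoint)
open import Data.List.Relation.Unary.Unique.Propositional using (Unique)
import Data.List.Relation.Unary.Unique.Propositional.Properties as Unique
open import Data.Nat.Base using (ℕ; suc; _+_; _*_; _≤_; ∣_-_∣)
open import Data.Nat.Divisibility using (_∣_; _∣?_)
import Data.Nat.Properties as ℕ
open import Data.Product.Base using (_×_; _,_; ∃-syntax; Σ-syntax)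
open import Data.Product.Properties using (≡-dec)
open import Data.Rational.Base as ℚ using (ℚ; 0ℚ; 1ℚ)
import Data.Rational.Properties as ℚ
open import Data.Sum.Base using (_⊎_; inj₁; inj₂; swap)
import Data.Sum.Properties as Sum
open import Data.Sum.Relation.Binary.Pointwise
  using (Pointwise; ⊎-symmetric; ⊎-decidable)
open import Level using (0ℓ)
open import Relation.Binary.Core using (Rel)
open import Relation.Binary.Definitions
  using (Symmetric; Decidable; DecidableEquality)
open import Relation.Binary.PropositionalEquality
  using (_≡_; _≢_; refl; sym; trans; subst)
open import Relation.Nullary.Decidable
  using (yes; no; does; ¬?; _×-dec_; _⊎-dec_)
open import Relation.Nullary.Negation using (contradiction)
import Relation.Unary as U

open import Algebra.Properties.Semiring.Sum
  (CommutativeRing.semiring ℚ.+-*-commutativeRing) public using (sum)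

------------------------------------------------------------------------
-- Matrices

Matrix : ℕ → ℕ → Set
Matrix m n = Fin m → Fin n → ℚ

infix 4 _≋_
_≋_ : ∀ {m n} → Rel (Matrix m n) 0ℓ
A ≋ B = ∀ i j → A i j ≡ B i j

infixl 7 _·_
_·_ : ∀ {l m n} → Matrix l m → Matrix m n → Matrix l n
(A · B) i k = sum (λ j → A i j ℚ.* B j k)

identity : ∀ n → Matrix n n
identity n i j = if does (i Fin.≟ j) then 1ℚ else 0ℚ

-- Similarity of rational matrices over ℚ does not depend on the field
-- extension of ℚ over which the conjugating matrix is taken.
Similar : ∀ {n} → Rel (Matrix n n) 0ℓ
Similar {n} A B =
  ∃[ P ] ∃[ P⁻¹ ]
    (P · P⁻¹ ≋ identity n) × (P⁻¹ · P ≋ identity n) × (B ≋ P⁻¹ · A · P)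

------------------------------------------------------------------------
-- Finite weighted graphs, loops allowed

-- The vertex set consists of the entries of the list `vertices`, not of
-- the whole type `Vertex`; the values of `weight` at non-adjacent pairs
-- carry no meaning.
record WeightedGraph : Set₁ where
  field
    Vertex     : Set
    vertices   : List Vertex
    unique     : Unique vertices
    Adj        : Rel Vertex 0ℓ
    adj?       : Decidable Adj
    adj-sym    : Symmetric Adj
    weight     : Vertex → Vertex → ℚ
    weight-sym : ∀ u v → weight u v ≡ weight v u

  order : ℕ
  order = length vertices

  entry : Vertex → Vertex → ℚ
  entry u v = if does (adj? u v) then weight u v else 0ℚ

  adjacencyMatrix : Matrix order order
  adjacencyMatrix i j = entry (lookup vertices i) (lookup vertices j)

open WeightedGraph

infix 4 _∼_
_∼_ : WeightedGraph → WeightedGraph → Set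
G ∼ H = Σ[ eq ∈ order G ≡ order H ]
  Similar (subst (λ k → Matrix k k) eq (adjacencyMatrix G)) (adjacencyMatrix H)

infixr 6 _∪̇_
_∪̇_ : WeightedGraph → WeightedGraph → WeightedGraph
G ∪̇ H = record
  { Vertex     = Vertex G ⊎ Vertex H
  ; vertices   = map inj₁ (vertices G) ++ map inj₂ (vertices H)
  ; unique     = Unique.++⁺ (Unique.map⁺ Sum.inj₁-injective (unique G))
                            (Unique.map⁺ Sum.inj₂-injective (unique H))
                            disjoint
  ; Adj        = Pointwise (Adj G) (Adj H)
  ; adj?       = ⊎-decidable (adj? G) (adj? H)
  ; adj-sym    = ⊎-symmetric (adj-sym G) (adj-sym H)
  ; weight     = w
  ; weight-sym = w-sym
  }
  where
  disjoint : Disjoint (map inj₁ (vertices G)) (map inj₂ (vertices H))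
  disjoint (p , q) with ∈-map⁻ inj₁ p | ∈-map⁻ inj₂ q
  ... | _ , _ , refl | _ , _ , ()

  w : Vertex G ⊎ Vertex H → Vertex G ⊎ Vertex H → ℚ
  w (inj₁ u) (inj₁ v) = weight G u v
  w (inj₂ u) (inj₂ v) = weight H u v
  w (inj₁ _) (inj₂ _) = 0ℚ
  w (inj₂ _) (inj₁ _) = 0ℚ

  w-sym : ∀ u v → w u v ≡ w v u
  w-sym (inj₁ u) (inj₁ v) = weight-sym G u v
  w-sym (inj₂ u) (inj₂ v) = weight-sym H u v
  w-sym (inj₁ _) (inj₂ _) = refl
  w-sym (inj₂ _) (inj₁ _) = refl

induced : (G : WeightedGraph) {S : U.Pred (Vertex G) 0ℓ} → U.Decidable S →
          WeightedGraph
induced G S? = record G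
  { vertices = filter S? (vertices G)
  ; unique   = Unique.filter⁺ S? (unique G)
  }

-- A loop already present at a vertex would have its weight replaced by c.
withLoops : (G : WeightedGraph) → DecidableEquality (Vertex G) → ℚ →
            WeightedGraph
withLoops G _≟_ c = record G
  { Adj        = λ u v → u ≡ v ⊎ Adj G u v
  ; adj?       = λ u v → (u ≟ v) ⊎-dec adj? G u v
  ; adj-sym    = λ { (inj₁ eq) → inj₁ (sym eq) ; (inj₂ e) → inj₂ (adj-sym G e) }
  ; weight     = w
  ; weight-sym = w-sym
  }
  where
  w : Vertex G → Vertex G → ℚ
  w u v = if does (u ≟ v) then c else weight G u v

  w-sym : ∀ u v → w u v ≡ w v u
  w-sym u v with u ≟ v | v ≟ u
  ... | yes _  | yes _  = refl
  ... | yes eq | no neq = contradiction (sym eq) neq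
  ... | no neq | yes eq = contradiction (sym eq) neq
  ... | no _   | no _   = weight-sym G u v

------------------------------------------------------------------------
-- Paths

P : ℕ → WeightedGraph
P n = record
  { Vertex     = Fin n
  ; vertices   = allFin n
  ; unique     = Unique.allFin⁺ n
  ; Adj        = λ i j → suc (toℕ i) ≡ toℕ j ⊎ suc (toℕ j) ≡ toℕ i
  ; adj?       = λ i j → (suc (toℕ i) ℕ.≟ toℕ j) ⊎-dec (suc (toℕ j) ℕ.≟ toℕ i)
  ; adj-sym    = swap
  ; weight     = λ _ _ → 1ℚ
  ; weight-sym = λ _ _ → refl
  }

Q Q′ : ℕ → WeightedGraph
Q  n = withLoops (P n) Fin._≟_ (+ 2 ℚ./ 1)
Q′ n = withLoops (P n) Fin._≟_ (-[1+ 1 ] ℚ./ 1)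

------------------------------------------------------------------------
-- Odd Aztec diamonds

-- Unit squares, as (row , column) counted from the top left corner.
Square : ℕ → Set
Square k = Fin k × Fin k

-- The corner (0 , 0) is black.
Black : ∀ {k} → Square k → Set
Black (i , j) = 2 ∣ toℕ i + toℕ j

black? : ∀ {k} → U.Decidable (Black {k})
black? (i , j) = 2 ∣? (toℕ i + toℕ j)

-- [i , i+1] × [j , j+1] and [i′ , i′+1] × [j′ , j′+1] have a corner in
-- common iff ∣ i - i′ ∣ ≤ 1 and ∣ j - j′ ∣ ≤ 1.
ShareCorner : ∀ {k} → Rel (Square k) 0ℓ
ShareCorner (i , j) (i′ , j′) =
  ∣ toℕ i - toℕ i′ ∣ ≤ 1 × ∣ toℕ j - toℕ j′ ∣ ≤ 1

shareCorner? : ∀ {k} → Decidable (ShareCorner {k})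
shareCorner? (i , j) (i′ , j′) =
  (∣ toℕ i - toℕ i′ ∣ ℕ.≤? 1) ×-dec (∣ toℕ j - toℕ j′ ∣ ℕ.≤? 1)

shareCorner-sym : ∀ {k} → Symmetric (ShareCorner {k})
shareCorner-sym {_} {i , j} {i′ , j′} (p , q) =
  subst (_≤ 1) (ℕ.∣-∣-comm (toℕ i) (toℕ i′)) p ,
  subst (_≤ 1) (ℕ.∣-∣-comm (toℕ j) (toℕ j′)) q

OD : ℕ → WeightedGraph
OD n = record
  { Vertex     = Square k
  ; vertices   = filter black? (cartesianProduct (allFin k) (allFin k))
  ; unique     = Unique.filter⁺ black?
                   (Unique.cartesianProduct⁺ (Unique.allFin⁺ k) (Unique.allFin⁺ k))
  ; Adj        = λ s t → s ≢ t × ShareCorner s t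
  ; adj?       = λ s t → ¬? (≡-dec Fin._≟_ Fin._≟_ s t) ×-dec shareCorner? s t
  ; adj-sym    = λ { {s} {t} (s≢t , c) →
                     (λ eq → s≢t (sym eq)) , shareCorner-sym {k} {s} {t} c }
  ; weight     = λ _ _ → 1ℚ
  ; weight-sym = λ _ _ → refl
  }
  where
  k : ℕ
  k = suc (2 * n)

-- On or above the diagonal from the top left to the bottom right corner.
OnOrAboveDiagonal : ∀ {k} → Square k → Set
OnOrAboveDiagonal (i , j) = i Fin.≤ j

onOrAboveDiagonal? : ∀ {k} → U.Decidable (OnOrAboveDiagonal {k})
onOrAboveDiagonal? (i , j) = i Fin.≤? j

HOD : ℕ → WeightedGraph
HOD n = induced (OD n) onOrAboveDiagonal?

{-# OPTIONS --safe #-}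
module Submission where

-- Write a function f on OD n as a matrix supported on the black squares, and
-- let A be the adjacency matrix of the path on 2n + 1 vertices; OD n then acts
-- as f ↦ A f A.  The following linear maps intertwine this action with the
-- five summands:
--   * the antisymmetric part of f, which is a function on HOD (n - 1);
--   * the antisymmetric part of A² f - f A²;
--   * the pairing of f with the projection onto the kernel of A;
--   * the pairings of A f + f A with the Chebyshev polynomials U₁, U₃, …
--     of A / 2, because A² acts on these as Q n;
--   * the same for (A f - f A) J, where J = diag (1, -1, 1, …) anticommutes
--     with A.
-- If f is killed by all of them, then f is symmetric, hence A² f - f A² is
-- antisymmetric and so zero.  Therefore A f + f A and (A f - f A) J commute with
-- A, i.e. are polynomials in A.  They are orthogonal to every polynomial that
-- could occur in them, so they vanish by positivity; this leaves A f = f A = 0,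
-- whence f is a multiple of the kernel projection, and again zero by positivity.
-- Both sides have the same order, and an injective square matrix is invertible.

open import Defs
open import Algebra.Bundles using (CommutativeRing; Semiring)
import Algebra.Properties.Semiring.Sum as SemiringSum
open import Data.Bool.Base using (true; false; if_then_else_)
open import Data.Fin.Base using (Fin; zero; suc; toℕ; fromℕ<; punchIn; punchOut)
open import Data.Fin.Properties as Fin
  using (any?; punchIn-punchOut; toℕ<n; toℕ-injective; toℕ-fromℕ<)
open import Data.List.Base
  using (List; []; _∷_; length; lookup; map; _++_; filter; allFin; tabulate; cartesianProduct)
open import Data.List.Membership.Propositional using (_∈_)
open import Data.List.Membership.Propositional.Properties
  using (∈-lookup; ∈-map⁻; ∈-map⁺; ∈-++⁻; ∈-++⁺ˡ; ∈-++⁺ʳ; ∈-filter⁺; ∈-filter⁻;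
         ∈-cartesianProduct⁺; ∈-allFin)
open import Data.List.Properties using (length-++; length-map; length-tabulate)
import Data.List.Relation.Unary.All as All
open import Data.List.Relation.Unary.AllPairs using (_∷_)
open import Data.List.Relation.Unary.Any using (index)
open import Data.List.Relation.Unary.Any.Properties using (lookup-index)
open import Data.List.Relation.Unary.Unique.Propositional using (Unique)
open import Data.Nat
  using (ℕ; zero; suc; _≤_; _<_; _≥_; _∸_; z≤n; s≤s; z<s; s<s; s≤s⁻¹; s<s⁻¹; ∣_-_∣; _≡ᵇ_)
import Data.Nat as ℕ
import Data.Nat.Properties as ℕ
open import Data.Nat.Divisibility
  using (_∣_; _∣?_; divides; _∣0; ∣-refl; ∣m+n∣m⇒∣n; ∣m∣n⇒∣m+n; m∣m*n; >⇒∤)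
import Data.Nat.Solver as ℕSolver
open import Data.Product using (_×_; _,_; ∃-syntax; proj₁; proj₂)
open import Data.Rational using (ℚ; 0ℚ; 1ℚ; _+_; _*_; _-_; -_)
import Data.Rational as ℚ
import Data.Rational.Properties as ℚ
open import Data.Rational.Solver using (module +-*-Solver)
open import Data.Sum using (_⊎_; inj₁; inj₂; [_,_]′)
open import Function using (_∘_; flip)
open import Level using (0ℓ)
open import Relation.Binary.Definitions using (tri<; tri≈; tri>)
open import Relation.Binary.PropositionalEquality
  using (_≡_; _≢_; refl; sym; trans; cong; cong₂; subst; module ≡-Reasoning)
open import Relation.Nullary using (¬_; Dec; yes; no; does; contradiction)
open import Relation.Nullary.Decidable using (¬?; _⊎-dec_; decidable-stable; dec-true; dec-false)
open import Relation.Unary using (Pred; Decidable)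
open SemiringSum (CommutativeRing.semiring ℚ.+-*-commutativeRing)
  using (sum-cong-≗; sum-replicate-zero; ∑-distrib-+; ∑-comm; *-distribˡ-sum; *-distribʳ-sum)
module ℕΣ = SemiringSum ℕ.+-*-semiring
open WeightedGraph using (Vertex; vertices; order; unique; entry; adj?; adjacencyMatrix)

-- Sums over lists

-- The choice of maps comes from the eigenvectors of A. If v and w have eigenvalues x and y, then f
-- = v wᵀ is multiplied by xy under the action, by x² - y² under A² f - f A², by x + y under A f + f
-- A and by x - y under A f - f A. The even antisymmetric matrices involve exactly the pairs with x²
-- ≠ y², and A² f - f A² carries the symmetric matrices of such pairs to antisymmetric ones; hence
-- two copies of the same graph. The remaining pairs have x = y ≠ 0, x = -y ≠ 0 or x = y = 0, and
-- the corresponding eigenvalues x², -x² and 0 make up the spectra of `Q n`, `Q′ n` and `P 1`. The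
-- obstacle is that these eigenvalues are cosines, in general irrational. Polynomials in A therefore
-- take the place of eigenvectors. They can be handled over ℚ because a matrix commuting with A is
-- determined by its first row, and positivity of a sum of rational squares takes the place of
-- orthogonal diagonalisation.

module ListSum (R : Semiring 0ℓ 0ℓ) where
  private module R = Semiring R
  open R using (Carrier; _≈_; 0#) renaming (_+_ to _⊞_)
  open SemiringSum R using (sum-cong-≋) renaming (sum to ⨁)

  ∑ˡ : ∀ {A : Set} → List A → (A → Carrier) → Carrier
  ∑ˡ xs f = ⨁ (λ i → f (lookup xs i))

  ∑ˡ-++ : ∀ {A : Set} (xs ys : List A) f → ∑ˡ (xs ++ ys) f ≈ ∑ˡ xs f ⊞ ∑ˡ ys f
  ∑ˡ-++ []       ys f = R.sym (R.+-identityˡ (∑ˡ ys f))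
  ∑ˡ-++ (x ∷ xs) ys f = R.trans (R.+-congˡ (∑ˡ-++ xs ys f))
    (R.sym (R.+-assoc (f x) (∑ˡ xs f) (∑ˡ ys f)))

  ∑ˡ-map : ∀ {A B : Set} (g : A → B) xs f → ∑ˡ (map g xs) f ≈ ∑ˡ xs (f ∘ g)
  ∑ˡ-map g []       f = R.refl
  ∑ˡ-map g (x ∷ xs) f = R.+-congˡ (∑ˡ-map g xs f)

  ∑ˡ-filter : ∀ {A : Set} {P : Pred A 0ℓ} (P? : Decidable P) xs f →
              ∑ˡ (filter P? xs) f ≈ ∑ˡ xs (λ x → if does (P? x) then f x else 0#)
  ∑ˡ-filter P? []       f = R.refl
  ∑ˡ-filter P? (x ∷ xs) f with does (P? x)
  ... | true  = R.+-congˡ (∑ˡ-filter P? xs f)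
  ... | false = R.trans (∑ˡ-filter P? xs f) (R.sym (R.+-identityˡ _))

  ∑ˡ-cartesianProduct : ∀ {A B : Set} (xs : List A) (ys : List B) f →
    ∑ˡ (cartesianProduct xs ys) f ≈ ∑ˡ xs (λ x → ∑ˡ ys (λ y → f (x , y)))
  ∑ˡ-cartesianProduct []       ys f = R.refl
  ∑ˡ-cartesianProduct (x ∷ xs) ys f =
    R.trans (∑ˡ-++ (map (x ,_) ys) (cartesianProduct xs ys) f)
          (R.+-cong (∑ˡ-map (x ,_) ys f) (∑ˡ-cartesianProduct xs ys f))

  ∑ˡ-tabulate : ∀ {A : Set} {n} (g : Fin n → A) f → ∑ˡ (tabulate g) f ≈ ⨁ (f ∘ g)
  ∑ˡ-tabulate {n = zero}  g f = R.refl
  ∑ˡ-tabulate {n = suc n} g f = R.+-congˡ (∑ˡ-tabulate (g ∘ suc) f)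

  ∑ˡ-allFin² : ∀ m n (f : Fin m × Fin n → Carrier) →
    ∑ˡ (cartesianProduct (allFin m) (allFin n)) f ≈ ⨁ (λ i → ⨁ (λ j → f (i , j)))
  ∑ˡ-allFin² m n f = R.trans (∑ˡ-cartesianProduct (allFin m) (allFin n) f)
    (R.trans (∑ˡ-tabulate (λ i → i) (λ i → ∑ˡ (allFin n) (λ j → f (i , j))))
           (sum-cong-≋ (λ i → ∑ˡ-tabulate (λ j → j) (λ j → f (i , j)))))

-- The same rules serve twice: in ℕ they count vertices, in ℚ they evaluate rows of matrix products.
module ListSumℕ = ListSum ℕ.+-*-semiring
open ListSum (CommutativeRing.semiring ℚ.+-*-commutativeRing)

-- The orders of the two graphs

2∣2+ : ∀ {m} → 2 ∣ m → 2 ∣ 2 ℕ.+ m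
2∣2+ = ∣m∣n⇒∣m+n ∣-refl

even-or-odd : ∀ m → 2 ∣ m ⊎ 2 ∣ suc m
even-or-odd zero    = inj₁ (2 ∣0)
even-or-odd (suc m) with even-or-odd m
... | inj₁ 2∣m  = inj₂ (2∣2+ 2∣m)
... | inj₂ 2∣1+m = inj₁ 2∣1+m

even⇒suc-odd : ∀ {m} → 2 ∣ m → ¬ 2 ∣ suc m
even⇒suc-odd {m} 2∣m 2∣1+m =
  >⇒∤ (s≤s (s≤s z≤n)) (∣m+n∣m⇒∣n (subst (2 ∣_) (ℕ.+-comm 1 m) 2∣1+m) 2∣m)

even[m+m] : ∀ m → 2 ∣ m ℕ.+ m
even[m+m] m = subst (2 ∣_) (cong (m ℕ.+_) (ℕ.+-identityʳ m)) (m∣m*n m)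

[even_] : ℕ → ℕ
[even m ] = if does (2 ∣? m) then 1 else 0

[even]-even : ∀ {m} → 2 ∣ m → [even m ] ≡ 1
[even]-even {m} e = cong (if_then 1 else 0) (dec-true (2 ∣? m) e)

[even]-odd : ∀ {m} → ¬ 2 ∣ m → [even m ] ≡ 0
[even]-odd {m} o = cong (if_then 1 else 0) (dec-false (2 ∣? m) o)

[even]-suc : ∀ m → [even m ] ℕ.+ [even suc m ] ≡ 1
[even]-suc m with even-or-odd m
... | inj₁ 2∣m   = cong₂ ℕ._+_ ([even]-even 2∣m) ([even]-odd (even⇒suc-odd 2∣m))
... | inj₂ 2∣1+m = cong₂ ℕ._+_ ([even]-odd (λ 2∣m → even⇒suc-odd 2∣m 2∣1+m)) ([even]-even 2∣1+m)

[even]-2+ : ∀ m → [even 2 ℕ.+ m ] ≡ [even m ]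
[even]-2+ m = ℕ.+-cancelˡ-≡ [even suc m ] [even 2 ℕ.+ m ] [even m ]
  (trans ([even]-suc (suc m)) (sym (trans (ℕ.+-comm [even suc m ] [even m ]) ([even]-suc m))))

-- Of two consecutive squares in a row exactly one is black. Peeling off two columns replaces the
-- offset `a` by `2 + a`, so the induction has to keep `a` general.
∑-even : ∀ a n → ℕΣ.sum {suc (2 ℕ.* n)} (λ j → [even a ℕ.+ toℕ j ]) ≡ n ℕ.+ [even a ]
∑-even a zero    = trans (ℕ.+-identityʳ [even a ℕ.+ 0 ]) (cong [even_] (ℕ.+-identityʳ a))
∑-even a (suc n) = begin
  ∑ (suc (2 ℕ.* suc n)) a      ≡⟨ cong (λ k → ∑ (suc k) a) (ℕ.*-suc 2 n) ⟩
  ∑ (3 ℕ.+ 2 ℕ.* n) a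
    ≡⟨ cong₂ (λ x y → x ℕ.+ (y ℕ.+ ℕΣ.sum {suc (2 ℕ.* n)} (λ j → [even a ℕ.+ (2 ℕ.+ toℕ j) ])))
             (cong [even_] (ℕ.+-identityʳ a)) (cong [even_] (ℕ.+-comm a 1)) ⟩
  [even a ] ℕ.+ ([even suc a ] ℕ.+ ℕΣ.sum {suc (2 ℕ.* n)} (λ j → [even a ℕ.+ (2 ℕ.+ toℕ j) ]))
    ≡⟨ ℕ.+-assoc [even a ] [even suc a ] _ ⟨
  [even a ] ℕ.+ [even suc a ] ℕ.+ ℕΣ.sum {suc (2 ℕ.* n)} (λ j → [even a ℕ.+ (2 ℕ.+ toℕ j) ])
    ≡⟨ cong₂ ℕ._+_ ([even]-suc a) (ℕΣ.sum-cong-≗ {suc (2 ℕ.* n)}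
         (λ j → cong [even_] (shift (toℕ j)))) ⟩
  suc (∑ (suc (2 ℕ.* n)) (2 ℕ.+ a))  ≡⟨ cong suc (∑-even (2 ℕ.+ a) n) ⟩
  suc n ℕ.+ [even 2 ℕ.+ a ]          ≡⟨ cong (suc n ℕ.+_) ([even]-2+ a) ⟩
  suc n ℕ.+ [even a ]                ∎
  where
  open ≡-Reasoning
  ∑ : ℕ → ℕ → ℕ
  ∑ k a = ℕΣ.sum {k} (λ j → [even a ℕ.+ toℕ j ])
  shift : ∀ j → a ℕ.+ (2 ℕ.+ j) ≡ 2 ℕ.+ a ℕ.+ j
  shift j = trans (ℕ.+-suc a (suc j)) (cong suc (ℕ.+-suc a j))

length-∑ : ∀ {A : Set} (xs : List A) → length xs ≡ ListSumℕ.∑ˡ xs (λ _ → 1)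
length-∑ []       = refl
length-∑ (x ∷ xs) = cong suc (length-∑ xs)

∑-const : ∀ n c → ℕΣ.sum {n} (λ _ → c) ≡ n ℕ.* c
∑-const zero    c = refl
∑-const (suc n) c = cong (c ℕ.+_) (∑-const n c)

order-OD-∑ : ∀ n → order (OD n) ≡
  ℕΣ.sum {suc (2 ℕ.* n)} (λ i → ℕΣ.sum {suc (2 ℕ.* n)} (λ j → [even toℕ i ℕ.+ toℕ j ]))
order-OD-∑ n = trans (length-∑ (vertices (OD n)))
  (trans (ListSumℕ.∑ˡ-filter black? (cartesianProduct (allFin k) (allFin k)) (λ _ → 1))
         (ListSumℕ.∑ˡ-allFin² k k (λ u → if does (black? u) then 1 else 0)))
  where
  k : ℕ
  k = suc (2 ℕ.* n)

order-OD : ∀ n → order (OD n) ≡ suc (2 ℕ.* n) ℕ.* n ℕ.+ (n ℕ.+ 1)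
order-OD n = begin
  order (OD n)  ≡⟨ order-OD-∑ n ⟩
  ℕΣ.sum {suc (2 ℕ.* n)} (λ i → ℕΣ.sum {suc (2 ℕ.* n)} (λ j → [even toℕ i ℕ.+ toℕ j ]))
    ≡⟨ ℕΣ.sum-cong-≗ {suc (2 ℕ.* n)} (λ i → ∑-even (toℕ i) n) ⟩
  ℕΣ.sum {suc (2 ℕ.* n)} (λ i → n ℕ.+ [even toℕ i ])
    ≡⟨ ℕΣ.∑-distrib-+ {suc (2 ℕ.* n)} (λ _ → n) (λ i → [even toℕ i ]) ⟩
  ℕΣ.sum {suc (2 ℕ.* n)} (λ _ → n) ℕ.+ ℕΣ.sum {suc (2 ℕ.* n)} (λ i → [even toℕ i ])
    ≡⟨ cong₂ ℕ._+_ (∑-const (suc (2 ℕ.* n)) n) (∑-even 0 n) ⟩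
  suc (2 ℕ.* n) ℕ.* n ℕ.+ (n ℕ.+ 1) ∎
  where open ≡-Reasoning

[_≟_] : ℕ → ℕ → ℕ
[ a ≟ b ] = if a ≡ᵇ b then 1 else 0

[≟]-refl : ∀ a → [ a ≟ a ] ≡ 1
[≟]-refl zero    = refl
[≟]-refl (suc a) = [≟]-refl a

[≟]-≢ : ∀ {a b} → a ≢ b → [ a ≟ b ] ≡ 0
[≟]-≢ {zero}  {zero}  a≢b = contradiction refl a≢b
[≟]-≢ {zero}  {suc b} a≢b = refl
[≟]-≢ {suc a} {zero}  a≢b = refl
[≟]-≢ {suc a} {suc b} a≢b = [≟]-≢ (λ a≡b → a≢b (cong suc a≡b))

∑-[≟] : ∀ {n} (i : Fin n) → ℕΣ.sum {n} (λ j → [ toℕ i ≟ toℕ j ]) ≡ 1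
∑-[≟] {suc n} zero    = cong suc (trans (∑-const n 0) (ℕ.*-zeroʳ n))
∑-[≟] {suc n} (suc i) = ∑-[≟] {n} i

-- The conditionals are nested in the way in which the two filters defining `HOD` unfold.
[_≤_,even] : ℕ → ℕ → ℕ
[ a ≤ b ,even] = if does (2 ∣? (a ℕ.+ b)) then (if does (a ℕ.≤? b) then 1 else 0) else 0

-- Reflection exchanges the two closed halves of the board. They overlap exactly in the diagonal,
-- all of whose squares are black.
[≤,even]-symmetrised : ∀ a b →
  [ a ≤ b ,even] ℕ.+ [ b ≤ a ,even] ≡ [even a ℕ.+ b ] ℕ.+ [ a ≟ b ]
[≤,even]-symmetrised a b rewrite ℕ.+-comm b a with ℕ.<-cmp a b
... | tri< a<b a≢b _
  rewrite dec-true (a ℕ.≤? b) (ℕ.<⇒≤ a<b) | dec-false (b ℕ.≤? a) (ℕ.<⇒≱ a<b) | [≟]-≢ a≢b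
  with does (2 ∣? (a ℕ.+ b))
...   | true  = refl
...   | false = refl
[≤,even]-symmetrised a b | tri≈ _ refl _
  rewrite dec-true (a ℕ.≤? a) ℕ.≤-refl | dec-true (2 ∣? (a ℕ.+ a)) (even[m+m] a) | [≟]-refl a =
    refl
[≤,even]-symmetrised a b | tri> _ a≢b b<a
  rewrite dec-true (b ℕ.≤? a) (ℕ.<⇒≤ b<a) | dec-false (a ℕ.≤? b) (ℕ.<⇒≱ b<a) | [≟]-≢ a≢b
  with does (2 ∣? (a ℕ.+ b))
...   | true  = refl
...   | false = refl

order-HOD-∑ : ∀ n → order (HOD n) ≡
  ℕΣ.sum {suc (2 ℕ.* n)} (λ i → ℕΣ.sum {suc (2 ℕ.* n)} (λ j → [ toℕ i ≤ toℕ j ,even]))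
order-HOD-∑ n = begin
  order (HOD n)
    ≡⟨ length-∑ (vertices (HOD n)) ⟩
  ListSumℕ.∑ˡ (vertices (HOD n)) (λ _ → 1)
    ≡⟨ ListSumℕ.∑ˡ-filter onOrAboveDiagonal? (vertices (OD n)) (λ _ → 1) ⟩
  ListSumℕ.∑ˡ (vertices (OD n)) (λ u → if does (onOrAboveDiagonal? u) then 1 else 0)
    ≡⟨ ListSumℕ.∑ˡ-filter black? (cartesianProduct (allFin k) (allFin k))
         (λ u → if does (onOrAboveDiagonal? u) then 1 else 0) ⟩
  ListSumℕ.∑ˡ (cartesianProduct (allFin k) (allFin k)) (λ u →
    if does (black? u) then (if does (onOrAboveDiagonal? u) then 1 else 0) else 0)
    ≡⟨ ListSumℕ.∑ˡ-allFin² k k (λ u →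
         if does (black? u) then (if does (onOrAboveDiagonal? u) then 1 else 0) else 0) ⟩
  ℕΣ.sum {k} (λ i → ℕΣ.sum {k} (λ j → [ toℕ i ≤ toℕ j ,even])) ∎
  where
  open ≡-Reasoning
  k : ℕ
  k = suc (2 ℕ.* n)

-- Counting the double avoids a sum over a triangle: the half and its mirror image cover the board
-- and count the diagonal twice.
order-HOD : ∀ n → order (HOD n) ≡ suc n ℕ.* suc n
order-HOD n = ℕ.*-cancelˡ-≡ (order (HOD n)) (suc n ℕ.* suc n) 2 (begin
  2 ℕ.* order (HOD n)  ≡⟨ cong (order (HOD n) ℕ.+_) (ℕ.+-identityʳ (order (HOD n))) ⟩
  order (HOD n) ℕ.+ order (HOD n)
    ≡⟨ cong₂ ℕ._+_ (order-HOD-∑ n) (trans (order-HOD-∑ n)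
         (ℕΣ.∑-comm {k} {k} (λ i j → [ toℕ i ≤ toℕ j ,even]))) ⟩
  ∑∑ (λ i j → [ i ≤ j ,even]) ℕ.+ ∑∑ (λ j i → [ i ≤ j ,even])
    ≡⟨ ∑∑-+ (λ i j → [ i ≤ j ,even]) (λ j i → [ i ≤ j ,even]) ⟨
  ∑∑ (λ i j → [ i ≤ j ,even] ℕ.+ [ j ≤ i ,even])
    ≡⟨ ℕΣ.sum-cong-≗ {k} (λ i → ℕΣ.sum-cong-≗ {k} (λ j → [≤,even]-symmetrised (toℕ i) (toℕ j))) ⟩
  ∑∑ (λ i j → [even i ℕ.+ j ] ℕ.+ [ i ≟ j ])
    ≡⟨ ∑∑-+ (λ i j → [even i ℕ.+ j ]) [_≟_] ⟩
  ∑∑ (λ i j → [even i ℕ.+ j ]) ℕ.+ ∑∑ [_≟_]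
    ≡⟨ cong₂ ℕ._+_ (trans (sym (order-OD-∑ n)) (order-OD n))
         (trans (ℕΣ.sum-cong-≗ {k} (∑-[≟] {k})) (∑-const k 1)) ⟩
  k ℕ.* n ℕ.+ (n ℕ.+ 1) ℕ.+ k ℕ.* 1
    ≡⟨ solve 1 (λ n → (con 1 :+ con 2 :* n) :* n :+ (n :+ con 1) :+ (con 1 :+ con 2 :* n) :* con 1
                   := con 2 :* ((con 1 :+ n) :* (con 1 :+ n))) refl n ⟩
  2 ℕ.* (suc n ℕ.* suc n) ∎)
  where
  open ≡-Reasoning
  open ℕSolver.+-*-Solver
  k : ℕ
  k = suc (2 ℕ.* n)
  ∑∑ : (ℕ → ℕ → ℕ) → ℕ
  ∑∑ f = ℕΣ.sum {k} (λ i → ℕΣ.sum {k} (λ j → f (toℕ i) (toℕ j)))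
  ∑∑-+ : ∀ f g → ∑∑ (λ i j → f i j ℕ.+ g i j) ≡ ∑∑ f ℕ.+ ∑∑ g
  ∑∑-+ f g = trans
    (ℕΣ.sum-cong-≗ {k} (λ i → ℕΣ.∑-distrib-+ {k} (λ j → f (toℕ i) (toℕ j))
      (λ j → g (toℕ i) (toℕ j))))
    (ℕΣ.∑-distrib-+ {k} (λ i → ℕΣ.sum {k} (λ j → f (toℕ i) (toℕ j)))
      (λ i → ℕΣ.sum {k} (λ j → g (toℕ i) (toℕ j))))

order-∪̇ : ∀ G H → order (G ∪̇ H) ≡ order G ℕ.+ order H
order-∪̇ G H = trans (length-++ (map inj₁ (vertices G)))
  (cong₂ ℕ._+_ (length-map inj₁ (vertices G)) (length-map inj₂ (vertices H)))

orders-agree : ∀ m → order (OD (suc m)) ≡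
  order (HOD m ∪̇ HOD m ∪̇ P 1 ∪̇ Q (suc m) ∪̇ Q′ (suc m))
orders-agree m = begin
  order (OD n)                                                ≡⟨ order-OD n ⟩
  suc (2 ℕ.* n) ℕ.* n ℕ.+ (n ℕ.+ 1)
    ≡⟨ solve 1 (λ n → (con 1 :+ con 2 :* n) :* n :+ (n :+ con 1)
                   := n :* n :+ (n :* n :+ (con 1 :+ (n :+ n)))) refl n ⟩
  n ℕ.* n ℕ.+ (n ℕ.* n ℕ.+ (1 ℕ.+ (n ℕ.+ n)))
    ≡⟨ cong₂ (λ h q → h ℕ.+ (h ℕ.+ (1 ℕ.+ (q ℕ.+ q)))) (order-HOD m)
         (length-tabulate {n = n} (λ i → i)) ⟨
  order (HOD m) ℕ.+ (order (HOD m) ℕ.+ (1 ℕ.+ (order (Q n) ℕ.+ order (Q′ n))))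
    ≡⟨ cong (λ x → order (HOD m) ℕ.+ (order (HOD m) ℕ.+ (1 ℕ.+ x))) (order-∪̇ (Q n) (Q′ n)) ⟨
  order (HOD m) ℕ.+ (order (HOD m) ℕ.+ (1 ℕ.+ order (Q n ∪̇ Q′ n)))
    ≡⟨ cong (λ x → order (HOD m) ℕ.+ (order (HOD m) ℕ.+ x)) (order-∪̇ (P 1) (Q n ∪̇ Q′ n)) ⟨
  order (HOD m) ℕ.+ (order (HOD m) ℕ.+ order (P 1 ∪̇ Q n ∪̇ Q′ n))
    ≡⟨ cong (order (HOD m) ℕ.+_) (order-∪̇ (HOD m) (P 1 ∪̇ Q n ∪̇ Q′ n)) ⟨
  order (HOD m) ℕ.+ order (HOD m ∪̇ P 1 ∪̇ Q n ∪̇ Q′ n)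
    ≡⟨ order-∪̇ (HOD m) (HOD m ∪̇ P 1 ∪̇ Q n ∪̇ Q′ n) ⟨
  order (HOD m ∪̇ HOD m ∪̇ P 1 ∪̇ Q n ∪̇ Q′ n) ∎
  where
  open ≡-Reasoning
  open ℕSolver.+-*-Solver
  n : ℕ
  n = suc m

-- Injective square matrices

open +-*-Solver using (solve; _:=_; _:+_; _:*_; _:-_; :-_; con)

sum-zero : ∀ {n} (f : Fin n → ℚ) → (∀ i → f i ≡ 0ℚ) → sum f ≡ 0ℚ
sum-zero {n} f f≡0 = trans (sum-cong-≗ f≡0) (sum-replicate-zero n)

sum-linear : ∀ {n} c (f g : Fin n → ℚ) →
             sum (λ i → f i + c * g i) ≡ sum f + c * sum g
sum-linear c f g = trans (∑-distrib-+ f (λ i → c * g i))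
                         (cong (sum f +_) (sym (*-distribˡ-sum c g)))

sum-minus : ∀ {n} (f g : Fin n → ℚ) → sum (λ i → f i - g i) ≡ sum f - sum g
sum-minus f g = begin
  sum (λ i → f i - g i)          ≡⟨ sum-cong-≗ (λ i → solve 2
    (λ x y → x :- y := x :+ con (- 1ℚ) :* y) refl (f i) (g i)) ⟩
  sum (λ i → f i + - 1ℚ * g i)   ≡⟨ sum-linear (- 1ℚ) f g ⟩
  sum f + - 1ℚ * sum g           ≡⟨ solve 2 (λ x y → x :+ con (- 1ℚ) :* y := x :- y) refl (sum f)
    (sum g) ⟩
  sum f - sum g                  ∎
  where open ≡-Reasoning

sum-identity : ∀ {n} (f : Fin n → ℚ) i → sum (λ j → identity n i j * f j) ≡ f i
sum-identity {suc n} f zero = begin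
  1ℚ * f zero + sum (λ j → 0ℚ * f (suc j))
    ≡⟨ cong₂ _+_ (ℚ.*-identityˡ (f zero)) (sum-zero (λ j → 0ℚ * f (suc j))
         (λ j → ℚ.*-zeroˡ (f (suc j)))) ⟩
  f zero + 0ℚ  ≡⟨ ℚ.+-identityʳ (f zero) ⟩
  f zero       ∎
  where open ≡-Reasoning
sum-identity {suc n} f (suc i) = begin
  0ℚ * f zero + sum (λ j → identity n i j * f (suc j))
    ≡⟨ cong₂ _+_ (ℚ.*-zeroˡ (f zero)) (sum-identity (f ∘ suc) i) ⟩
  0ℚ + f (suc i)  ≡⟨ ℚ.+-identityˡ (f (suc i)) ⟩
  f (suc i)       ∎
  where open ≡-Reasoning

identity-sym : ∀ {n} (i j : Fin n) → identity n i j ≡ identity n j i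
identity-sym zero    zero    = refl
identity-sym zero    (suc j) = refl
identity-sym (suc i) zero    = refl
identity-sym (suc i) (suc j) = identity-sym i j

·-assoc : ∀ {k l m n} (A : Matrix k l) (B : Matrix l m) (C : Matrix m n) →
          A · B · C ≋ A · (B · C)
·-assoc A B C i j = begin
  sum (λ b → sum (λ a → A i a * B a b) * C b j)
    ≡⟨ sum-cong-≗ (λ b → *-distribʳ-sum (C b j) (λ a → A i a * B a b)) ⟩
  sum (λ b → sum (λ a → A i a * B a b * C b j))
    ≡⟨ ∑-comm (λ b a → A i a * B a b * C b j) ⟩
  sum (λ a → sum (λ b → A i a * B a b * C b j))
    ≡⟨ sum-cong-≗ (λ a → trans (sum-cong-≗ (λ b → ℚ.*-assoc (A i a) (B a b) (C b j)))
                                (sym (*-distribˡ-sum (A i a) (λ b → B a b * C b j)))) ⟩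
  sum (λ a → A i a * sum (λ b → B a b * C b j)) ∎
  where open ≡-Reasoning

·-congˡ : ∀ {l m n} (A : Matrix l m) {B C : Matrix m n} → B ≋ C → A · B ≋ A · C
·-congˡ A B≋C i k = sum-cong-≗ (λ j → cong (A i j *_) (B≋C j k))

·-congʳ : ∀ {l m n} {A B : Matrix l m} (C : Matrix m n) → A ≋ B → A · C ≋ B · C
·-congʳ C A≋B i k = sum-cong-≗ (λ j → cong (_* C j k) (A≋B i j))

infixl 7 _·ᵥ_
_·ᵥ_ : ∀ {m n} → Matrix m n → (Fin n → ℚ) → Fin m → ℚ
(A ·ᵥ x) i = sum (λ j → A i j * x j)

Injective : ∀ {m n} → Matrix m n → Set
Injective A = ∀ x → (∀ i → (A ·ᵥ x) i ≡ 0ℚ) → ∀ j → x j ≡ 0ℚ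

-- One step of Gaussian elimination in column `zero`. The matrix `reduced` is the Schur complement
-- of the pivot, and `extend β x` solves row `p` with right-hand side `β` for the eliminated
-- unknown.
module Pivot {n} (A : Matrix (suc n) (suc n)) (p : Fin (suc n)) (u : ℚ)
             (pivot : A p zero * u ≡ 1ℚ) where

  reduced : Matrix n n
  reduced i j = A (punchIn p i) (suc j) + - (A (punchIn p i) zero * u) * A p (suc j)

  rest : Fin (suc n) → (Fin n → ℚ) → ℚ
  rest i x = sum (λ j → A i (suc j) * x j)

  extend : ℚ → (Fin n → ℚ) → Fin (suc n) → ℚ
  extend β x zero    = u * (β - rest p x)
  extend β x (suc j) = x j

  row-pivot : ∀ β x → (A ·ᵥ extend β x) p ≡ β
  row-pivot β x = begin
    A p zero * (u * (β - rest p x)) + rest p x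
      ≡⟨ cong (_+ rest p x) (sym (ℚ.*-assoc (A p zero) u (β - rest p x))) ⟩
    A p zero * u * (β - rest p x) + rest p x
      ≡⟨ cong (λ c → c * (β - rest p x) + rest p x) pivot ⟩
    1ℚ * (β - rest p x) + rest p x
      ≡⟨ solve 2 (λ b r → con 1ℚ :* (b :- r) :+ r := b) refl β (rest p x) ⟩
    β ∎
    where open ≡-Reasoning

  row-other : ∀ β x k → (A ·ᵥ extend β x) (punchIn p k) ≡
              (reduced ·ᵥ x) k + A (punchIn p k) zero * u * β
  row-other β x k = begin
    a * (u * (β - rest p x)) + rest i x
      ≡⟨ solve 5 (λ a u β r s → a :* (u :* (β :- r)) :+ s :=
                   s :+ (:- (a :* u)) :* r :+ a :* u :* β) refl a u β (rest p x) (rest i x) ⟩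
    rest i x + - (a * u) * rest p x + a * u * β
      ≡⟨ cong (_+ a * u * β) (sym reduced-row) ⟩
    (reduced ·ᵥ x) k + a * u * β ∎
    where
    open ≡-Reasoning
    i = punchIn p k
    a = A i zero
    reduced-row : (reduced ·ᵥ x) k ≡ rest i x + - (a * u) * rest p x
    reduced-row = trans
      (sum-cong-≗ (λ j → solve 4 (λ s c r x → (s :+ c :* r) :* x := s :* x :+ c :* (r :* x))
                           refl (A i (suc j)) (- (a * u)) (A p (suc j)) (x j)))
      (sum-linear (- (a * u)) (λ j → A i (suc j) * x j) (λ j → A p (suc j) * x j))

  by-rows : ∀ {P : Fin (suc n) → Set} → P p → (∀ k → P (punchIn p k)) → ∀ i → P i
  by-rows {P} Pp Pk i with p Fin.≟ i
  ... | yes refl = Pp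
  ... | no p≢i   = subst P (punchIn-punchOut p≢i) (Pk (punchOut p≢i))

-- Elimination by induction on the size. A zero first column would put a unit vector into the
-- kernel, so a pivot exists; the Schur complement is again injective because `extend 0ℚ` carries
-- its kernel into that of `A`.
injective⇒surjective : ∀ {n} (A : Matrix n n) → Injective A →
                       (b : Fin n → ℚ) → ∃[ x ] ∀ i → (A ·ᵥ x) i ≡ b i
injective⇒surjective {zero}  A inj b = (λ ()) , λ ()
injective⇒surjective {suc n} A inj b with any? (λ i → ¬? (A i zero ℚ.≟ 0ℚ))
... | no none = contradiction (inj e₀ Ae₀≡0 zero) λ ()
  where
  e₀ : Fin (suc n) → ℚ
  e₀ zero    = 1ℚ
  e₀ (suc _) = 0ℚ
  Ae₀≡0 : ∀ i → (A ·ᵥ e₀) i ≡ 0ℚ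
  Ae₀≡0 i = sum-zero (λ j → A i j * e₀ j) λ
    { zero    → trans (ℚ.*-identityʳ (A i zero))
                  (decidable-stable (A i zero ℚ.≟ 0ℚ) (λ a≢0 → none (i , a≢0)))
    ; (suc j) → ℚ.*-zeroʳ (A i (suc j)) }
... | yes (p , a≢0) =
  extend (b p) x , by-rows (row-pivot (b p) x) λ k → begin
    (A ·ᵥ extend (b p) x) (punchIn p k)                ≡⟨ row-other (b p) x k ⟩
    (reduced ·ᵥ x) k + A (punchIn p k) zero * u * b p 
      ≡⟨ cong (_+ A (punchIn p k) zero * u * b p) (proj₂ solution k) ⟩
    b (punchIn p k) - A (punchIn p k) zero * u * b p + A (punchIn p k) zero * u * b p
      ≡⟨ solve 2 (λ x y → x :- y :+ y := x) refl (b (punchIn p k))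
           (A (punchIn p k) zero * u * b p) ⟩
    b (punchIn p k) ∎
  where
  open ≡-Reasoning
  instance
    a-nonZero : ℚ.NonZero (A p zero)
    a-nonZero = ℚ.≢-nonZero a≢0
  u : ℚ
  u = ℚ.1/ (A p zero)
  open Pivot A p u (ℚ.*-inverseʳ (A p zero))
  reduced-injective : Injective reduced
  reduced-injective x rx≡0 j = inj (extend 0ℚ x) (by-rows (row-pivot 0ℚ x) λ k →
    trans (row-other 0ℚ x k)
      (trans (cong₂ _+_ (rx≡0 k) (ℚ.*-zeroʳ (A (punchIn p k) zero * u))) refl)) (suc j)
  solution : ∃[ x ] ∀ k → (reduced ·ᵥ x) k ≡ b (punchIn p k) - A (punchIn p k) zero * u * b p
  solution = injective⇒surjective reduced reduced-injective
    (λ k → b (punchIn p k) - A (punchIn p k) zero * u * b p)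
  x = proj₁ solution

-- Solving for each unit vector gives a right inverse `B`. The columns of `B · A` minus the identity
-- are killed by `A`, so injectivity makes `B` a left inverse too.
injective⇒invertible : ∀ {n} (A : Matrix n n) → Injective A →
                       ∃[ B ] (A · B ≋ identity n) × (B · A ≋ identity n)
injective⇒invertible {n} A inj = B , AB≋1 , BA≋1
  where
  open ≡-Reasoning
  B : Matrix n n
  B i j = proj₁ (injective⇒surjective A inj (λ k → identity n k j)) i
  AB≋1 : A · B ≋ identity n
  AB≋1 i j = proj₂ (injective⇒surjective A inj (λ k → identity n k j)) i
  BA≋1 : B · A ≋ identity n
  BA≋1 i j = begin
    (B · A) i j                          ≡⟨ solve 2 (λ x y → x := x :- y :+ y) refl ((B · A) i j)
      (identity n i j) ⟩
    (B · A) i j - identity n i j + identity n i j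
      ≡⟨ cong (_+ identity n i j) (inj (λ k → (B · A) k j - identity n k j) kernel i) ⟩
    0ℚ + identity n i j                  ≡⟨ ℚ.+-identityˡ (identity n i j) ⟩
    identity n i j                       ∎
    where
    kernel : ∀ i → (A ·ᵥ (λ k → (B · A) k j - identity n k j)) i ≡ 0ℚ
    kernel i = begin
      sum (λ k → A i k * ((B · A) k j - identity n k j))
        ≡⟨ sum-cong-≗ (λ k → solve 3 (λ a x y → a :* (x :- y) := a :* x :- y :* a) refl
                                (A i k) ((B · A) k j) (identity n k j)) ⟩
      sum (λ k → A i k * (B · A) k j - identity n k j * A i k)
        ≡⟨ sum-minus (λ k → A i k * (B · A) k j) (λ k → identity n k j * A i k) ⟩
      (A · (B · A)) i j - sum (λ k → identity n k j * A i k)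
        ≡⟨ cong₂ _-_
             (trans (sym (·-assoc A B A i j))
               (trans (·-congʳ A AB≋1 i j) (sum-identity (λ k → A k j) i)))
             (trans (sum-cong-≗ (λ k → cong (_* A i k) (identity-sym k j)))
               (sum-identity (A i) j)) ⟩
      A i j - A i j  ≡⟨ ℚ.+-inverseʳ (A i j) ⟩
      0ℚ             ∎

·-identityʳ : ∀ {m n} (A : Matrix m n) → A · identity n ≋ A
·-identityʳ {n = n} A i j = begin
  sum (λ k → A i k * identity n k j)
    ≡⟨ sum-cong-≗ (λ k → trans (cong (A i k *_) (identity-sym k j))
                                (ℚ.*-comm (A i k) (identity n j k))) ⟩
  sum (λ k → identity n j k * A i k)  ≡⟨ sum-identity (A i) j ⟩
  A i j                               ∎
  where open ≡-Reasoning

-- Thanks to this, no formula for an inverse of `Θ` is needed. As `Θ` maps from the space of `A` to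
-- that of `B`, the conjugating matrix in `Similar` is `Θ⁻¹`.
injective-intertwiner⇒similar :
  ∀ {m n} (eq : m ≡ n) (A : Matrix m m) (B : Matrix n n) (Θ : Matrix n m) →
  Θ · A ≋ B · Θ → Injective Θ → Similar (subst (λ k → Matrix k k) eq A) B
injective-intertwiner⇒similar {m} refl A B Θ ΘA≋BΘ inj =
  Θ⁻¹ , Θ , proj₂ (proj₂ inverse) , proj₁ (proj₂ inverse) , λ i j → begin
    B i j                 ≡⟨ ·-identityʳ B i j ⟨
    (B · identity m) i j  ≡⟨ ·-congˡ B (proj₁ (proj₂ inverse)) i j ⟨
    (B · (Θ · Θ⁻¹)) i j   ≡⟨ ·-assoc B Θ Θ⁻¹ i j ⟨
    (B · Θ · Θ⁻¹) i j     ≡⟨ ·-congʳ Θ⁻¹ ΘA≋BΘ i j ⟨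
    (Θ · A · Θ⁻¹) i j     ∎
  where
  open ≡-Reasoning
  inverse : ∃[ B ] (Θ · B ≋ identity m) × (B · Θ ≋ identity m)
  inverse = injective⇒invertible Θ inj
  Θ⁻¹ : Matrix m m
  Θ⁻¹ = proj₁ inverse

-- Sums over initial segments of ℕ

∑ : ℕ → (ℕ → ℚ) → ℚ
∑ zero    f = 0ℚ
∑ (suc n) f = f 0 + ∑ n (f ∘ suc)

∑≡sum : ∀ n (f : ℕ → ℚ) → ∑ n f ≡ sum {n} (λ i → f (toℕ i))
∑≡sum zero    f = refl
∑≡sum (suc n) f = cong (f 0 +_) (∑≡sum n (f ∘ suc))

∑-cong : ∀ n {f g : ℕ → ℚ} → (∀ {i} → i < n → f i ≡ g i) → ∑ n f ≡ ∑ n g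
∑-cong zero    f≡g = refl
∑-cong (suc n) f≡g = cong₂ _+_ (f≡g z<s) (∑-cong n (λ i<n → f≡g (s<s i<n)))

∑-cong² : ∀ m n {f g : ℕ → ℕ → ℚ} → (∀ {i j} → i < m → j < n → f i j ≡ g i j) →
          ∑ m (λ i → ∑ n (f i)) ≡ ∑ m (λ i → ∑ n (g i))
∑-cong² m n f≡g = ∑-cong m (λ i<m → ∑-cong n (λ j<n → f≡g i<m j<n))

∑-zero : ∀ n {f : ℕ → ℚ} → (∀ {i} → i < n → f i ≡ 0ℚ) → ∑ n f ≡ 0ℚ
∑-zero zero    f≡0 = refl
∑-zero (suc n) f≡0 = cong₂ _+_ (f≡0 z<s) (∑-zero n (λ i<n → f≡0 (s<s i<n)))

∑-+ : ∀ n (f g : ℕ → ℚ) → ∑ n (λ i → f i + g i) ≡ ∑ n f + ∑ n g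
∑-+ zero    f g = refl
∑-+ (suc n) f g = begin
  f 0 + g 0 + ∑ n (λ i → f (suc i) + g (suc i)) 
    ≡⟨ cong (f 0 + g 0 +_) (∑-+ n (f ∘ suc) (g ∘ suc)) ⟩
  f 0 + g 0 + (∑ n (f ∘ suc) + ∑ n (g ∘ suc))
    ≡⟨ solve 4 (λ a b c d → (a :+ b) :+ (c :+ d) := (a :+ c) :+ (b :+ d)) refl
         (f 0) (g 0) (∑ n (f ∘ suc)) (∑ n (g ∘ suc)) ⟩
  f 0 + ∑ n (f ∘ suc) + (g 0 + ∑ n (g ∘ suc))    ∎
  where open ≡-Reasoning

∑-*ˡ : ∀ n c (f : ℕ → ℚ) → ∑ n (λ i → c * f i) ≡ c * ∑ n f
∑-*ˡ zero    c f = sym (ℚ.*-zeroʳ c)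
∑-*ˡ (suc n) c f = trans (cong (c * f 0 +_) (∑-*ˡ n c (f ∘ suc)))
                         (sym (ℚ.*-distribˡ-+ c (f 0) (∑ n (f ∘ suc))))

∑-neg : ∀ n (f : ℕ → ℚ) → ∑ n (λ i → - f i) ≡ - ∑ n f
∑-neg zero    f = refl
∑-neg (suc n) f = trans (cong (- f 0 +_) (∑-neg n (f ∘ suc)))
                        (sym (ℚ.neg-distrib-+ (f 0) (∑ n (f ∘ suc))))

∑-minus : ∀ n (f g : ℕ → ℚ) → ∑ n (λ i → f i - g i) ≡ ∑ n f - ∑ n g
∑-minus n f g = trans (∑-+ n f (λ i → - g i)) (cong (∑ n f +_) (∑-neg n g))

∑-swap : ∀ m n (f : ℕ → ℕ → ℚ) →
         ∑ m (λ i → ∑ n (λ j → f i j)) ≡ ∑ n (λ j → ∑ m (λ i → f i j))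
∑-swap zero    n f = sym (∑-zero n (λ _ → refl))
∑-swap (suc m) n f = trans (cong (∑ n (f 0) +_) (∑-swap m n (f ∘ suc)))
                           (sym (∑-+ n (f 0) (λ j → ∑ m (λ i → f (suc i) j))))

∑-last : ∀ n (f : ℕ → ℚ) → ∑ (suc n) f ≡ ∑ n f + f n
∑-last zero    f = ℚ.+-comm (f 0) 0ℚ
∑-last (suc n) f = trans (cong (f 0 +_) (∑-last n (f ∘ suc)))
                         (sym (ℚ.+-assoc (f 0) (∑ n (f ∘ suc)) (f (suc n))))

square-nonNeg : ∀ p → 0ℚ ℚ.≤ p * p
square-nonNeg p with ℚ.≤-total 0ℚ p
... | inj₁ 0≤p = subst (ℚ._≤ p * p) (ℚ.*-zeroˡ p) (ℚ.*-monoʳ-≤-nonNeg p {{ℚ.nonNegative 0≤p}} 0≤p)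
... | inj₂ p≤0 = subst (ℚ._≤ p * p) (ℚ.*-zeroˡ p) (ℚ.*-monoʳ-≤-nonPos p {{ℚ.nonPositive p≤0}} p≤0)

sum-of-nonNegs≡0 : ∀ {p q} → 0ℚ ℚ.≤ p → 0ℚ ℚ.≤ q → p + q ≡ 0ℚ → p ≡ 0ℚ
sum-of-nonNegs≡0 {p} {q} 0≤p 0≤q p+q≡0 =
  ℚ.≤-antisym (subst (p ℚ.≤_) p+q≡0 (subst (ℚ._≤ p + q) (ℚ.+-identityʳ p) (ℚ.+-monoʳ-≤ p 0≤q)))
    0≤p

∑-nonNeg : ∀ n {f : ℕ → ℚ} → (∀ i → 0ℚ ℚ.≤ f i) → 0ℚ ℚ.≤ ∑ n f
∑-nonNeg zero    0≤f = ℚ.≤-refl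
∑-nonNeg (suc n) {f} 0≤f = subst (ℚ._≤ f 0 + ∑ n (f ∘ suc)) (ℚ.+-identityʳ 0ℚ)
  (ℚ.+-mono-≤ (0≤f 0) (∑-nonNeg n (0≤f ∘ suc)))

∑-nonNeg≡0 : ∀ n {f : ℕ → ℚ} → (∀ i → 0ℚ ℚ.≤ f i) → ∑ n f ≡ 0ℚ →
             ∀ {i} → i < n → f i ≡ 0ℚ
∑-nonNeg≡0 (suc n) {f} 0≤f ∑≡0 {zero} _ =
  sum-of-nonNegs≡0 (0≤f 0) (∑-nonNeg n (0≤f ∘ suc)) ∑≡0
∑-nonNeg≡0 (suc n) {f} 0≤f ∑≡0 {suc i} i<n =
  ∑-nonNeg≡0 n (0≤f ∘ suc)
    (sum-of-nonNegs≡0 (∑-nonNeg n (0≤f ∘ suc)) (0≤f 0)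
      (trans (ℚ.+-comm (∑ n (f ∘ suc)) (f 0)) ∑≡0)) (s<s⁻¹ i<n)

square≡0 : ∀ p → p * p ≡ 0ℚ → p ≡ 0ℚ
square≡0 p p²≡0 with p ℚ.≟ 0ℚ
... | yes p≡0 = p≡0
... | no p≢0 = begin
  p                ≡⟨ ℚ.*-identityʳ p ⟨
  p * 1ℚ           ≡⟨ cong (p *_) (ℚ.*-inverseʳ p) ⟨
  p * (p * ℚ.1/ p) ≡⟨ ℚ.*-assoc p p (ℚ.1/ p) ⟨
  p * p * ℚ.1/ p   ≡⟨ cong (_* ℚ.1/ p) p²≡0 ⟩
  0ℚ * ℚ.1/ p      ≡⟨ ℚ.*-zeroˡ (ℚ.1/ p) ⟩
  0ℚ               ∎
  where
  open ≡-Reasoning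
  instance
    p-nonZero : ℚ.NonZero p
    p-nonZero = ℚ.≢-nonZero p≢0

δ : ℕ → ℕ → ℚ
δ zero    zero    = 1ℚ
δ zero    (suc j) = 0ℚ
δ (suc i) zero    = 0ℚ
δ (suc i) (suc j) = δ i j

δ-refl : ∀ i → δ i i ≡ 1ℚ
δ-refl zero    = refl
δ-refl (suc i) = δ-refl i

δ-≢ : ∀ {i j} → i ≢ j → δ i j ≡ 0ℚ
δ-≢ {zero}  {zero}  i≢j = contradiction refl i≢j
δ-≢ {zero}  {suc j} i≢j = refl
δ-≢ {suc i} {zero}  i≢j = refl
δ-≢ {suc i} {suc j} i≢j = δ-≢ (i≢j ∘ cong suc)

δ-sym : ∀ i j → δ i j ≡ δ j i
δ-sym zero    zero    = refl
δ-sym zero    (suc j) = refl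
δ-sym (suc i) zero    = refl
δ-sym (suc i) (suc j) = δ-sym i j

δ-*-replace : ∀ i j (x : ℕ → ℚ) → δ i j * x j ≡ δ i j * x i
δ-*-replace zero    zero    x = refl
δ-*-replace zero    (suc j) x = trans (ℚ.*-zeroˡ (x (suc j))) (sym (ℚ.*-zeroˡ (x 0)))
δ-*-replace (suc i) zero    x = trans (ℚ.*-zeroˡ (x 0)) (sym (ℚ.*-zeroˡ (x (suc i))))
δ-*-replace (suc i) (suc j) x = δ-*-replace i j (x ∘ suc)

∑-δ : ∀ {n i} (x : ℕ → ℚ) → i < n → ∑ n (λ j → δ i j * x j) ≡ x i
∑-δ {suc n} {zero}  x i<n = trans
  (cong₂ _+_ (ℚ.*-identityˡ (x 0)) (∑-zero n (λ {j} _ → ℚ.*-zeroˡ (x (suc j)))))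
  (ℚ.+-identityʳ (x 0))
∑-δ {suc n} {suc i} x i<n = trans
  (cong₂ _+_ (ℚ.*-zeroˡ (x 0)) (∑-δ (x ∘ suc) (s<s⁻¹ i<n)))
  (ℚ.+-identityˡ (x (suc i)))

∑-δ-outside : ∀ n {i} (x : ℕ → ℚ) → n ≤ i → ∑ n (λ j → δ i j * x j) ≡ 0ℚ
∑-δ-outside n {i} x n≤i = ∑-zero n (λ {j} j<n →
  trans (cong (_* x j) (δ-≢ (λ i≡j → ℕ.<⇒≱ j<n (subst (n ≤_) i≡j n≤i)))) (ℚ.*-zeroˡ (x j)))

-- The adjacency matrix of the infinite path on ℕ; the end of a finite path enters only through the
-- range of the sums.
path : ℕ → ℕ → ℚ
path i j = δ (suc i) j + δ i (suc j)

path-sym : ∀ i j → path i j ≡ path j i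
path-sym i j = trans (cong₂ _+_ (δ-sym (suc i) j) (δ-sym i (suc j)))
  (ℚ.+-comm (δ j (suc i)) (δ (suc j) i))

-- The left boundary condition: the value at -1 is taken to be 0.
previous : (ℕ → ℚ) → ℕ → ℚ
previous x zero    = 0ℚ
previous x (suc i) = x i

ε : ℕ → ℚ
ε zero    = 1ℚ
ε (suc n) = - ε n

-- The path is bipartite: every edge joins an even vertex to an odd one, and the sign changes along
-- it.
path-ε : ∀ i j → path i j * ε j ≡ - (ε i * path i j)
path-ε i j = begin
  (δ (suc i) j + δ i (suc j)) * ε j
    ≡⟨ solve 3 (λ a b e → (a :+ b) :* e := a :* e :- b :* (:- e)) refl (δ (suc i) j) (δ i (suc j))
         (ε j) ⟩
  δ (suc i) j * ε j - δ i (suc j) * ε (suc j)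
    ≡⟨ cong₂ _-_ (δ-*-replace (suc i) j ε) (δ-*-replace i (suc j) ε) ⟩
  δ (suc i) j * - ε i - δ i (suc j) * ε i
    ≡⟨ solve 3 (λ a b e → a :* (:- e) :- b :* e := :- (e :* (a :+ b))) refl (δ (suc i) j)
         (δ i (suc j)) (ε i) ⟩
  - (ε i * (δ (suc i) j + δ i (suc j))) ∎
  where open ≡-Reasoning

-- Matrices acted on by the path

minus≡0⇒≡ : ∀ {p q} → p - q ≡ 0ℚ → p ≡ q
minus≡0⇒≡ {p} {q} p-q≡0 = begin
  p          ≡⟨ solve 2 (λ p q → p := p :- q :+ q) refl p q ⟩
  p - q + q  ≡⟨ cong (_+ q) p-q≡0 ⟩
  0ℚ + q     ≡⟨ ℚ.+-identityˡ q ⟩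
  q          ∎
  where open ≡-Reasoning

-- Indices in ℕ permit shifts such as `2 + j` without bounds; on a board of side `N` equality is
-- compared by `_≈_` in `PathGrid`.
Grid : Set
Grid = ℕ → ℕ → ℚ

infixl 6 _⊕_ _⊖_
_⊕_ _⊖_ : Grid → Grid → Grid
(f ⊕ g) i j = f i j + g i j
(f ⊖ g) i j = f i j - g i j

infixl 7 _⊛_
_⊛_ : ℚ → Grid → Grid
(c ⊛ f) i j = c * f i j

module PathGrid (N : ℕ) where

  infix 4 _≈_
  _≈_ : Grid → Grid → Set
  f ≈ g = ∀ {i j} → i < N → j < N → f i j ≡ g i j

  A* : (ℕ → ℚ) → ℕ → ℚ
  A* x i = ∑ N (λ a → path i a * x a)

  A*-cong : ∀ {x y : ℕ → ℚ} → (∀ {i} → i < N → x i ≡ y i) → ∀ i → A* x i ≡ A* y i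
  A*-cong x≡y i = ∑-cong N (λ {a} a<N → cong (path i a *_) (x≡y a<N))

  A*-minus : ∀ x y i → A* (λ a → x a - y a) i ≡ A* x i - A* y i
  A*-minus x y i = trans
    (∑-cong N (λ {a} _ → solve 3 (λ p x y → p :* (x :- y) := p :* x :- p :* y) refl (path i a)
      (x a) (y a)))
    (∑-minus N (λ a → path i a * x a) (λ a → path i a * y a))

  A*-plus : ∀ x y i → A* (λ a → x a + y a) i ≡ A* x i + A* y i
  A*-plus x y i = trans
    (∑-cong N (λ {a} _ → ℚ.*-distribˡ-+ (path i a) (x a) (y a)))
    (∑-+ N (λ a → path i a * x a) (λ a → path i a * y a))

  A*-*ˡ : ∀ c x i → A* (λ a → c * x a) i ≡ c * A* x i
  A*-*ˡ c x i = trans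
    (∑-cong N (λ {a} _ → solve 3 (λ p c x → p :* (c :* x) := c :* (p :* x)) refl (path i a) c
      (x a)))
    (∑-*ˡ N c (λ a → path i a * x a))

  A*-ε : ∀ x i → A* (λ a → ε a * x a) i ≡ - (ε i * A* x i)
  A*-ε x i = begin
    ∑ N (λ a → path i a * (ε a * x a))
      ≡⟨ ∑-cong N (λ {a} _ → trans (sym (ℚ.*-assoc (path i a) (ε a) (x a)))
           (trans (cong (_* x a) (path-ε i a))
             (solve 3 (λ e p x → (:- (e :* p)) :* x := (:- e) :* (p :* x)) refl (ε i) (path i a)
               (x a)))) ⟩
    ∑ N (λ a → - ε i * (path i a * x a))  ≡⟨ ∑-*ˡ N (- ε i) (λ a → path i a * x a) ⟩
    - ε i * A* x i                        ≡⟨ ℚ.neg-distribˡ-* (ε i) (A* x i) ⟨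
    - (ε i * A* x i)                      ∎
    where open ≡-Reasoning

  A*-δ : ∀ {k} i → k < N → A* (δ k) i ≡ path k i
  A*-δ {k} i k<N = begin
    ∑ N (λ a → path i a * δ k a)  ≡⟨ ∑-cong N (λ {a} _ → ℚ.*-comm (path i a) (δ k a)) ⟩
    ∑ N (λ a → δ k a * path i a)  ≡⟨ ∑-δ (path i) k<N ⟩
    path i k                      ≡⟨ path-sym i k ⟩
    path k i                      ∎
    where open ≡-Reasoning

  -- The sum has no term beyond the last vertex. The hypothesis on `x (suc i)` is the matching right
  -- boundary condition, under which the three-term recurrence holds up to the end.
  A*-neighbours : ∀ (x : ℕ → ℚ) {i} → i < N → (suc i ≡ N → x (suc i) ≡ 0ℚ) →
                  A* x i ≡ x (suc i) + previous x i
  A*-neighbours x {i} i<N end = begin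
    ∑ N (λ a → (δ (suc i) a + δ i (suc a)) * x a)
      ≡⟨ ∑-cong N (λ {a} _ → ℚ.*-distribʳ-+ (x a) (δ (suc i) a) (δ i (suc a))) ⟩
    ∑ N (λ a → δ (suc i) a * x a + δ i (suc a) * x a)
      ≡⟨ ∑-+ N (λ a → δ (suc i) a * x a) (λ a → δ i (suc a) * x a) ⟩
    ∑ N (λ a → δ (suc i) a * x a) + ∑ N (λ a → δ i (suc a) * x a)
      ≡⟨ cong₂ _+_ above (below i i<N) ⟩
    x (suc i) + previous x i ∎
    where
    open ≡-Reasoning
    above : ∑ N (λ a → δ (suc i) a * x a) ≡ x (suc i)
    above with suc i ℕ.<? N
    ... | yes 1+i<N = ∑-δ x 1+i<N
    ... | no  1+i≮N = trans (∑-δ-outside N x (ℕ.≮⇒≥ 1+i≮N))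
                            (sym (end (ℕ.≤-antisym i<N (ℕ.≮⇒≥ 1+i≮N))))
    below : ∀ i → i < N → ∑ N (λ a → δ i (suc a) * x a) ≡ previous x i
    below zero    _   = ∑-zero N (λ {a} _ → ℚ.*-zeroˡ (x a))
    below (suc i) i<N = ∑-δ x (ℕ.<-trans (ℕ.n<1+n i) i<N)

  -- In the kernel each value is minus the one two places before it, and the value at 1 is 0; so the
  -- value at 0 decides the rest.
  A*-kernel : ∀ (x : ℕ → ℚ) → x 0 ≡ 0ℚ → (∀ {i} → i < N → A* x i ≡ 0ℚ) →
              ∀ {i} → i < N → x i ≡ 0ℚ
  A*-kernel x x0≡0 Ax≡0 {zero}  _ = x0≡0
  A*-kernel x x0≡0 Ax≡0 {suc i} 1+i<N = begin
    x (suc i)                ≡⟨ ℚ.+-identityʳ (x (suc i)) ⟨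
    x (suc i) + 0ℚ           ≡⟨ cong (x (suc i) +_) (previous≡0 i i<N) ⟨
    x (suc i) + previous x i ≡⟨ A*-neighbours x i<N (λ 1+i≡N → contradiction 1+i≡N (ℕ.<⇒≢ 1+i<N))
      ⟨
    A* x i                   ≡⟨ Ax≡0 i<N ⟩
    0ℚ                       ∎
    where
    open ≡-Reasoning
    i<N : i < N
    i<N = ℕ.<-trans (ℕ.n<1+n i) 1+i<N
    previous≡0 : ∀ i → i < N → previous x i ≡ 0ℚ
    previous≡0 zero    _   = refl
    previous≡0 (suc i) i<N = A*-kernel x x0≡0 Ax≡0 (ℕ.<-trans (ℕ.n<1+n i) i<N)

  A*-selfAdjoint : ∀ x y → ∑ N (λ i → x i * A* y i) ≡ ∑ N (λ i → A* x i * y i)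
  A*-selfAdjoint x y = begin
    ∑ N (λ i → x i * ∑ N (λ a → path i a * y a))
      ≡⟨ ∑-cong N (λ {i} _ → sym (∑-*ˡ N (x i) (λ a → path i a * y a))) ⟩
    ∑ N (λ i → ∑ N (λ a → x i * (path i a * y a)))
      ≡⟨ ∑-swap N N (λ i a → x i * (path i a * y a)) ⟩
    ∑ N (λ a → ∑ N (λ i → x i * (path i a * y a)))
      ≡⟨ ∑-cong² N N (λ {a} {i} _ _ → trans
           (solve 3 (λ x p y → x :* (p :* y) := y :* (p :* x)) refl (x i) (path i a) (y a))
           (cong (λ p → y a * (p * x i)) (path-sym i a))) ⟩
    ∑ N (λ a → ∑ N (λ i → y a * (path a i * x i)))
      ≡⟨ ∑-cong N (λ {a} _ → trans (∑-*ˡ N (y a) (λ i → path a i * x i))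
           (ℚ.*-comm (y a) (A* x a))) ⟩
    ∑ N (λ a → A* x a * y a) ∎
    where open ≡-Reasoning

  -- Viewing grid functions as N × N matrices, left and right
  -- multiplication by the adjacency matrix of the path.
  left right : Grid → Grid
  left  f i j = A* (λ a → f a j) i
  right f i j = A* (f i) j

  left-cong : ∀ {f g} → f ≈ g → left f ≈ left g
  left-cong f≈g {i} i<N j<N = A*-cong (λ a<N → f≈g a<N j<N) i

  right-cong : ∀ {f g} → f ≈ g → right f ≈ right g
  right-cong f≈g {i} {j} i<N j<N = A*-cong (λ b<N → f≈g i<N b<N) j

  left-right : ∀ f i j → left (right f) i j ≡ right (left f) i j
  left-right f i j = begin
    ∑ N (λ a → path i a * ∑ N (λ b → path j b * f a b))
      ≡⟨ ∑-cong N (λ {a} _ → sym (∑-*ˡ N (path i a) (λ b → path j b * f a b))) ⟩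
    ∑ N (λ a → ∑ N (λ b → path i a * (path j b * f a b)))
      ≡⟨ ∑-swap N N (λ a b → path i a * (path j b * f a b)) ⟩
    ∑ N (λ b → ∑ N (λ a → path i a * (path j b * f a b)))
      ≡⟨ ∑-cong² N N (λ {b} {a} _ _ →
           solve 3 (λ p q f → p :* (q :* f) := q :* (p :* f)) refl (path i a) (path j b)
             (f a b)) ⟩
    ∑ N (λ b → ∑ N (λ a → path j b * (path i a * f a b)))
      ≡⟨ ∑-cong N (λ {b} _ → ∑-*ˡ N (path j b) (λ a → path i a * f a b)) ⟩
    ∑ N (λ b → path j b * ∑ N (λ a → path i a * f a b)) ∎
    where open ≡-Reasoning

  ⟨_,_⟩ : Grid → Grid → ℚ
  ⟨ f , g ⟩ = ∑ N (λ i → ∑ N (λ j → f i j * g i j))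

  ⟨⟩-cong : ∀ {f f′ g g′} → f ≈ f′ → g ≈ g′ → ⟨ f , g ⟩ ≡ ⟨ f′ , g′ ⟩
  ⟨⟩-cong f≈f′ g≈g′ = ∑-cong² N N (λ i<N j<N → cong₂ _*_ (f≈f′ i<N j<N) (g≈g′ i<N j<N))

  ⟨⟩-flip : ∀ f g → ⟨ flip f , flip g ⟩ ≡ ⟨ f , g ⟩
  ⟨⟩-flip f g = ∑-swap N N (λ i j → f j i * g j i)

  right-selfAdjoint : ∀ f g → ⟨ f , right g ⟩ ≡ ⟨ right f , g ⟩
  right-selfAdjoint f g = ∑-cong N (λ {i} _ → A*-selfAdjoint (f i) (g i))

  left-selfAdjoint : ∀ f g → ⟨ f , left g ⟩ ≡ ⟨ left f , g ⟩
  left-selfAdjoint f g = begin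
    ⟨ f , left g ⟩              ≡⟨ ⟨⟩-flip f (left g) ⟨
    ⟨ flip f , right (flip g) ⟩ ≡⟨ right-selfAdjoint (flip f) (flip g) ⟩
    ⟨ right (flip f) , flip g ⟩ ≡⟨ ⟨⟩-flip (left f) g ⟩
    ⟨ left f , g ⟩              ∎
    where open ≡-Reasoning

  ⟨⟩-definite : ∀ f → ⟨ f , f ⟩ ≡ 0ℚ → ∀ {i j} → i < N → j < N → f i j ≡ 0ℚ
  ⟨⟩-definite f ff≡0 {i} {j} i<N j<N = square≡0 (f i j)
    (∑-nonNeg≡0 N (λ j → square-nonNeg (f i j))
      (∑-nonNeg≡0 N (λ i → ∑-nonNeg N (λ j → square-nonNeg (f i j))) ff≡0 i<N) j<N)

  ⟨⟩-⊛ˡ : ∀ c f g → ⟨ c ⊛ f , g ⟩ ≡ c * ⟨ f , g ⟩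
  ⟨⟩-⊛ˡ c f g = begin
    ∑ N (λ i → ∑ N (λ j → c * f i j * g i j))
      ≡⟨ ∑-cong² N N (λ {i} {j} _ _ → ℚ.*-assoc c (f i j) (g i j)) ⟩
    ∑ N (λ i → ∑ N (λ j → c * (f i j * g i j)))
      ≡⟨ ∑-cong N (λ {i} _ → ∑-*ˡ N c (λ j → f i j * g i j)) ⟩
    ∑ N (λ i → c * ∑ N (λ j → f i j * g i j))
      ≡⟨ ∑-*ˡ N c (λ i → ∑ N (λ j → f i j * g i j)) ⟩
    c * ⟨ f , g ⟩ ∎
    where open ≡-Reasoning

  ⟨⟩-⊕ˡ : ∀ f g h → ⟨ f ⊕ g , h ⟩ ≡ ⟨ f , h ⟩ + ⟨ g , h ⟩
  ⟨⟩-⊕ˡ f g h = begin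
    ∑ N (λ i → ∑ N (λ j → (f i j + g i j) * h i j))
      ≡⟨ ∑-cong² N N (λ {i} {j} _ _ → ℚ.*-distribʳ-+ (h i j) (f i j) (g i j)) ⟩
    ∑ N (λ i → ∑ N (λ j → f i j * h i j + g i j * h i j))
      ≡⟨ ∑-cong N (λ {i} _ → ∑-+ N (λ j → f i j * h i j) (λ j → g i j * h i j)) ⟩
    ∑ N (λ i → ∑ N (λ j → f i j * h i j) + ∑ N (λ j → g i j * h i j))
      ≡⟨ ∑-+ N (λ i → ∑ N (λ j → f i j * h i j)) (λ i → ∑ N (λ j → g i j * h i j)) ⟩
    ⟨ f , h ⟩ + ⟨ g , h ⟩ ∎
    where open ≡-Reasoning

  ⟨⟩-∑ˡ : ∀ n (c : ℕ → ℚ) (f : ℕ → Grid) g →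
          ⟨ (λ i j → ∑ n (λ k → c k * f k i j)) , g ⟩ ≡ ∑ n (λ k → c k * ⟨ f k , g ⟩)
  ⟨⟩-∑ˡ zero    c f g = ∑-zero N (λ {i} _ → ∑-zero N (λ {j} _ → ℚ.*-zeroˡ (g i j)))
  ⟨⟩-∑ˡ (suc n) c f g = trans
    (⟨⟩-⊕ˡ (c 0 ⊛ f 0) (λ i j → ∑ n (λ k → c (suc k) * f (suc k) i j)) g)
    (cong₂ _+_ (⟨⟩-⊛ˡ (c 0) (f 0) g) (⟨⟩-∑ˡ n (c ∘ suc) (f ∘ suc) g))

  -- W (suc k) is the Chebyshev polynomial U k, at half the adjacency
  -- matrix of the path.
  W : ℕ → Grid
  W zero          = λ _ _ → 0ℚ
  W (suc zero)    = δ
  W (suc (suc k)) = left (W (suc k)) ⊖ W k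

  Commutes : Grid → Set
  Commutes f = left f ≈ right f

  left-⊖ : ∀ f g i j → left (f ⊖ g) i j ≡ left f i j - left g i j
  left-⊖ f g i j = A*-minus (λ a → f a j) (λ a → g a j) i

  right-⊖ : ∀ f g i j → right (f ⊖ g) i j ≡ right f i j - right g i j
  right-⊖ f g i j = A*-minus (f i) (g i) j

  commutes-⊖ : ∀ {f g} → Commutes f → Commutes g → Commutes (f ⊖ g)
  commutes-⊖ {f} {g} cf cg {i} {j} i<N j<N = begin
    left (f ⊖ g) i j           ≡⟨ left-⊖ f g i j ⟩
    left f i j - left g i j    ≡⟨ cong₂ _-_ (cf i<N j<N) (cg i<N j<N) ⟩
    right f i j - right g i j  ≡⟨ right-⊖ f g i j ⟨
    right (f ⊖ g) i j          ∎
    where open ≡-Reasoning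

  commutes-left : ∀ {f} → Commutes f → Commutes (left f)
  commutes-left {f} cf {i} {j} i<N j<N =
    trans (left-cong cf i<N j<N) (left-right f i j)

  commutes-δ : Commutes δ
  commutes-δ {i} {j} i<N j<N = begin
    A* (λ a → δ a j) i  ≡⟨ A*-cong (λ {a} _ → δ-sym a j) i ⟩
    A* (δ j) i          ≡⟨ A*-δ i j<N ⟩
    path j i            ≡⟨ path-sym j i ⟩
    path i j            ≡⟨ A*-δ j i<N ⟨
    A* (δ i) j          ∎
    where open ≡-Reasoning

  commutes-W : ∀ k → Commutes (W k)
  commutes-W zero    {i} {j} _ _ = trans
    (∑-zero N (λ {a} _ → ℚ.*-zeroʳ (path i a))) (sym (∑-zero N (λ {a} _ → ℚ.*-zeroʳ (path j a))))
  commutes-W (suc zero)    = commutes-δ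
  commutes-W (suc (suc k)) =
    commutes-⊖ {left (W (suc k))} {W k} (commutes-left (commutes-W (suc k))) (commutes-W k)

  -- The Chebyshev recurrence is the recurrence of the path itself, so these polynomials move the
  -- first unit vector along the path one step at a time. The range of `k` includes `suc N`, where
  -- the vector has left the path and the row is zero.
  W-firstRow : 0 < N → ∀ k {j} → k ≤ suc N → j < N → W k 0 j ≡ δ k (suc j)
  W-firstRow 0<N zero          _ _ = refl
  W-firstRow 0<N (suc zero) {j} _ _ = refl
  W-firstRow 0<N (suc (suc k)) {j} (s≤s k<N) j<N = begin
    left (W (suc k)) 0 j - W k 0 j
      -- Left multiplication would involve row 1; after commuting, `A` acts from the right and stays
      -- within row 0.
      ≡⟨ cong₂ _-_ (commutes-W (suc k) 0<N j<N) (W-firstRow 0<N k k≤1+N j<N) ⟩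
    A* (W (suc k) 0) j - δ k (suc j)
      ≡⟨ cong (_- δ k (suc j)) (A*-cong (λ b<N → W-firstRow 0<N (suc k) (ℕ.m≤n⇒m≤1+n k<N) b<N)
           j) ⟩
    A* (δ k) j - δ k (suc j)
      ≡⟨ cong (_- δ k (suc j)) (A*-δ j k<N) ⟩
    δ (suc k) j + δ k (suc j) - δ k (suc j)
      ≡⟨ solve 2 (λ x y → x :+ y :- y := x) refl (δ (suc k) j) (δ k (suc j)) ⟩
    δ (suc k) j ∎
    where
    open ≡-Reasoning
    k≤1+N : k ≤ suc N
    k≤1+N = ℕ.≤-trans (ℕ.n≤1+n k) (ℕ.m≤n⇒m≤1+n k<N)

  -- Row `i` of the commutation relation expresses row `suc i` of `f` through the two rows above it:
  -- the first unit vector is cyclic for the path.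
  commutes-determined : ∀ f → Commutes f → (∀ {j} → j < N → f 0 j ≡ 0ℚ) →
                        ∀ i {j} → i < N → j < N → f i j ≡ 0ℚ
  commutes-determined f cf row0 zero    _   j<N = row0 j<N
  commutes-determined f cf row0 (suc i) {j} 1+i<N j<N = begin
    f (suc i) j
      ≡⟨ ℚ.+-identityʳ (f (suc i) j) ⟨
    f (suc i) j + 0ℚ
      ≡⟨ cong (f (suc i) j +_) (previous≡0 i i<N) ⟨
    f (suc i) j + previous (λ a → f a j) i
      ≡⟨ A*-neighbours (λ a → f a j) i<N (λ 1+i≡N → contradiction 1+i≡N (ℕ.<⇒≢ 1+i<N)) ⟨
    left f i j
      ≡⟨ cf i<N j<N ⟩
    A* (f i) j
      ≡⟨ ∑-zero N (λ {b} b<N → trans (cong (path j b *_)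
           (commutes-determined f cf row0 i i<N b<N))
                                      (ℚ.*-zeroʳ (path j b))) ⟩
    0ℚ ∎
    where
    open ≡-Reasoning
    i<N : i < N
    i<N = ℕ.<-trans (ℕ.n<1+n i) 1+i<N
    previous≡0 : ∀ i → i < N → previous (λ a → f a j) i ≡ 0ℚ
    previous≡0 zero    _   = refl
    previous≡0 (suc i) i<N = commutes-determined f cf row0 i (ℕ.<-trans (ℕ.n<1+n i) i<N) j<N

  -- This is the Cayley-Hamilton theorem, since U of index `N` at half the argument is the
  -- characteristic polynomial of the path. Here it follows from the vanishing of the first row.
  W-end : ∀ {i j} → 0 < N → i < N → j < N → W (suc N) i j ≡ 0ℚ
  W-end {i} 0<N = commutes-determined (W (suc N)) (commutes-W (suc N))
    (λ {j} j<N → trans (W-firstRow 0<N (suc N) ℕ.≤-refl j<N)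
                       (δ-≢ (λ N≡j → ℕ.<⇒≢ j<N (sym N≡j)))) i

  commutes-∑ : ∀ n (c : ℕ → ℚ) (f : ℕ → Grid) → (∀ k → Commutes (f k)) →
               Commutes (λ i j → ∑ n (λ k → c k * f k i j))
  commutes-∑ zero c f cf = commutes-W 0
  commutes-∑ (suc n) c f cf {i} {j} i<N j<N = begin
    A* (λ a → c 0 * f 0 a j + rest a j) i
      ≡⟨ A*-plus (λ a → c 0 * f 0 a j) (λ a → rest a j) i ⟩
    A* (λ a → c 0 * f 0 a j) i + left rest i j
      ≡⟨ cong₂ _+_ (A*-*ˡ (c 0) (λ a → f 0 a j) i)
           (commutes-∑ n (c ∘ suc) (f ∘ suc) (cf ∘ suc) i<N j<N) ⟩
    c 0 * left (f 0) i j + right rest i j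
      ≡⟨ cong₂ _+_ (trans (cong (c 0 *_) (cf 0 i<N j<N)) (sym (A*-*ˡ (c 0) (f 0 i) j))) refl ⟩
    A* (λ b → c 0 * f 0 i b) j + right rest i j
      ≡⟨ A*-plus (λ b → c 0 * f 0 i b) (rest i) j ⟨
    A* (λ b → c 0 * f 0 i b + rest i b) j ∎
    where
    open ≡-Reasoning
    rest : Grid
    rest i j = ∑ n (λ k → c (suc k) * f (suc k) i j)

  -- The first row of `W (suc k)` is the `k`-th unit vector, so the coefficients of `f` as a
  -- polynomial in `A` can be read off from its own first row.
  expand : 0 < N → ∀ f → Commutes f → f ≈ (λ i j → ∑ N (λ k → f 0 k * W (suc k) i j))
  expand 0<N f cf {i} {j} i<N j<N = minus≡0⇒≡ (commutes-determined (f ⊖ g)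
      (commutes-⊖ {f} {g} cf (commutes-∑ N (f 0) (W ∘ suc) (commutes-W ∘ suc))) row0 i i<N j<N)
    where
    open ≡-Reasoning
    g : Grid
    g i j = ∑ N (λ k → f 0 k * W (suc k) i j)
    row0 : ∀ {j} → j < N → f 0 j - g 0 j ≡ 0ℚ
    row0 {j} j<N = begin
      f 0 j - ∑ N (λ k → f 0 k * W (suc k) 0 j)
        ≡⟨ cong (λ x → f 0 j - x) (∑-cong N (λ {k} k<N → trans
             (cong (f 0 k *_) (trans (W-firstRow 0<N (suc k) (s≤s (ℕ.<⇒≤ k<N)) j<N) (δ-sym k j)))
             (ℚ.*-comm (f 0 k) (δ j k)))) ⟩
      f 0 j - ∑ N (λ k → δ j k * f 0 k)
        ≡⟨ cong (λ x → f 0 j - x) (∑-δ (f 0) j<N) ⟩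
      f 0 j - f 0 j ≡⟨ ℚ.+-inverseʳ (f 0 j) ⟩
      0ℚ ∎

  -- Expanding one argument of `⟨ f , f ⟩` leaves only these products. Each may vanish for either of
  -- two reasons: the polynomial does not occur in `f`, or it is orthogonal to `f`.
  commutes-orthogonal : 0 < N → ∀ f → Commutes f →
    (∀ {k} → k < N → f 0 k * ⟨ W (suc k) , f ⟩ ≡ 0ℚ) → ∀ {i j} → i < N → j < N → f i j ≡ 0ℚ
  commutes-orthogonal 0<N f cf f⊥W = ⟨⟩-definite f (begin
    ⟨ f , f ⟩  ≡⟨ ⟨⟩-cong (expand 0<N f cf) (λ _ _ → refl) ⟩
    ⟨ (λ i j → ∑ N (λ k → f 0 k * W (suc k) i j)) , f ⟩
      ≡⟨ ⟨⟩-∑ˡ N (f 0) (W ∘ suc) f ⟩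
    ∑ N (λ k → f 0 k * ⟨ W (suc k) , f ⟩)
      ≡⟨ ∑-zero N f⊥W ⟩
    0ℚ ∎)
    where open ≡-Reasoning

-- Signs and the parity of grid functions

2ℚ : ℚ
2ℚ = 1ℚ + 1ℚ

double≡0 : ∀ p → p + p ≡ 0ℚ → p ≡ 0ℚ
double≡0 p 2p≡0 = begin
  p             ≡⟨ solve 1 (λ p → p := con ℚ.½ :* (p :+ p)) refl p ⟩
  ℚ.½ * (p + p) ≡⟨ cong (ℚ.½ *_) 2p≡0 ⟩
  ℚ.½ * 0ℚ      ≡⟨ ℚ.*-zeroʳ ℚ.½ ⟩
  0ℚ            ∎
  where open ≡-Reasoning

p≡-p⇒p≡0 : ∀ {p} → p ≡ - p → p ≡ 0ℚ
p≡-p⇒p≡0 {p} p≡-p = double≡0 p (trans (cong (p +_) p≡-p) (ℚ.+-inverseʳ p))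

neg-involutive : ∀ p → - - p ≡ p
neg-involutive = solve 1 (λ p → :- (:- p) := p) refl

ε-double : ∀ k → ε (k ℕ.* 2) ≡ 1ℚ
ε-double zero    = refl
ε-double (suc k) = trans (neg-involutive (ε (k ℕ.* 2))) (ε-double k)

ε-even : ∀ {m} → 2 ∣ m → ε m ≡ 1ℚ
ε-even (divides k refl) = ε-double k

ε-odd : ∀ {m} → 2 ∣ suc m → ε m ≡ - 1ℚ
ε-odd {m} 2∣1+m = trans (sym (neg-involutive (ε m))) (cong -_ (ε-even 2∣1+m))

ε-+ : ∀ i j → ε (i ℕ.+ j) ≡ ε i * ε j
ε-+ zero    j = sym (ℚ.*-identityˡ (ε j))
ε-+ (suc i) j = trans (cong -_ (ε-+ i j)) (ℚ.neg-distribˡ-* (ε i) (ε j))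

ε² : ∀ j → ε j * ε j ≡ 1ℚ
ε² zero    = refl
ε² (suc j) = trans (solve 1 (λ e → (:- e) :* (:- e) := e :* e) refl (ε j)) (ε² j)

-- Conjugation by the diagonal sign matrix multiplies `f` by `s`: for `s` equal to 1 the support is
-- black, for -1 it is white. In this algebraic form, a multiplication by the path negates `s` by
-- `path-ε`.
HasParity : ℚ → Grid → Set
HasParity s f = ∀ i j → ε i * ε j * f i j ≡ s * f i j

evenGrid-vanishes : ∀ {f} → HasParity 1ℚ f → ∀ {i j} → 2 ∣ suc (i ℕ.+ j) → f i j ≡ 0ℚ
evenGrid-vanishes {f} pf {i} {j} odd = p≡-p⇒p≡0 (begin
  f i j               ≡⟨ ℚ.*-identityˡ (f i j) ⟨
  1ℚ * f i j          ≡⟨ pf i j ⟨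
  ε i * ε j * f i j   ≡⟨ cong (_* f i j) (trans (sym (ε-+ i j)) (ε-odd odd)) ⟩
  - 1ℚ * f i j        ≡⟨ solve 1 (λ x → con (- 1ℚ) :* x := :- x) refl (f i j) ⟩
  - f i j             ∎)
  where open ≡-Reasoning

oddGrid-vanishes : ∀ {f} → HasParity (- 1ℚ) f → ∀ {i j} → 2 ∣ i ℕ.+ j → f i j ≡ 0ℚ
oddGrid-vanishes {f} pf {i} {j} even = p≡-p⇒p≡0 (begin
  f i j               ≡⟨ ℚ.*-identityˡ (f i j) ⟨
  1ℚ * f i j          ≡⟨ cong (_* f i j) (trans (sym (ε-+ i j)) (ε-even even)) ⟨
  ε i * ε j * f i j   ≡⟨ pf i j ⟩
  - 1ℚ * f i j        ≡⟨ solve 1 (λ x → con (- 1ℚ) :* x := :- x) refl (f i j) ⟩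
  - f i j             ∎)
  where open ≡-Reasoning

vanishing⇒even : ∀ {f} → (∀ {i j} → ¬ 2 ∣ i ℕ.+ j → f i j ≡ 0ℚ) → HasParity 1ℚ f
vanishing⇒even {f} f≡0 i j with even-or-odd (i ℕ.+ j)
... | inj₁ even = cong (_* f i j) (trans (sym (ε-+ i j)) (ε-even even))
... | inj₂ odd  = begin
  ε i * ε j * f i j  ≡⟨ cong (ε i * ε j *_) fij≡0 ⟩
  ε i * ε j * 0ℚ     ≡⟨ ℚ.*-zeroʳ (ε i * ε j) ⟩
  1ℚ * 0ℚ            ≡⟨ cong (1ℚ *_) fij≡0 ⟨
  1ℚ * f i j         ∎
  where
  open ≡-Reasoning
  fij≡0 : f i j ≡ 0ℚ
  fij≡0 = f≡0 (λ even → even⇒suc-odd even odd)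

parity-flip : ∀ {s f} → HasParity s f → HasParity s (flip f)
parity-flip {f = f} pf i j = trans (cong (_* f j i) (ℚ.*-comm (ε i) (ε j))) (pf j i)

parity-⊕ : ∀ {s f g} → HasParity s f → HasParity s g → HasParity s (f ⊕ g)
parity-⊕ {s} {f} {g} pf pg i j = begin
  ε i * ε j * (f i j + g i j)              ≡⟨ ℚ.*-distribˡ-+ (ε i * ε j) (f i j) (g i j) ⟩
  ε i * ε j * f i j + ε i * ε j * g i j    ≡⟨ cong₂ _+_ (pf i j) (pg i j) ⟩
  s * f i j + s * g i j                    ≡⟨ ℚ.*-distribˡ-+ s (f i j) (g i j) ⟨
  s * (f i j + g i j)                      ∎
  where open ≡-Reasoning

parity-⊖ : ∀ {s f g} → HasParity s f → HasParity s g → HasParity s (f ⊖ g)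
parity-⊖ {s} {f} {g} pf pg i j = begin
  ε i * ε j * (f i j - g i j)
    ≡⟨ solve 3 (λ e x y → e :* (x :- y) := e :* x :- e :* y) refl (ε i * ε j) (f i j) (g i j) ⟩
  ε i * ε j * f i j - ε i * ε j * g i j    ≡⟨ cong₂ _-_ (pf i j) (pg i j) ⟩
  s * f i j - s * g i j
    ≡⟨ solve 3 (λ s x y → s :* x :- s :* y := s :* (x :- y)) refl s (f i j) (g i j) ⟩
  s * (f i j - g i j)                      ∎
  where open ≡-Reasoning

twist : Grid → Grid
twist f i j = ε j * f i j

parity-twist : ∀ {s f} → HasParity s f → HasParity s (twist f)
parity-twist {s} {f} pf i j = begin
  ε i * ε j * (ε j * f i j)
    ≡⟨ solve 3 (λ a b x → a :* b :* (b :* x) := b :* (a :* b :* x)) refl (ε i) (ε j) (f i j) ⟩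
  ε j * (ε i * ε j * f i j)  ≡⟨ cong (ε j *_) (pf i j) ⟩
  ε j * (s * f i j)
    ≡⟨ solve 3 (λ e s x → e :* (s :* x) := s :* (e :* x)) refl (ε j) s (f i j) ⟩
  s * (ε j * f i j)          ∎
  where open ≡-Reasoning

-- cos (k π / 2)
quarterCos : ℕ → ℚ
quarterCos zero          = 1ℚ
quarterCos (suc zero)    = 0ℚ
quarterCos (suc (suc k)) = - quarterCos k

quarterCos-odd : ∀ k → quarterCos (suc (k ℕ.* 2)) ≡ 0ℚ
quarterCos-odd zero    = refl
quarterCos-odd (suc k) = cong -_ (quarterCos-odd k)

-- Commutators with the path and their compatibility with the diamond action

module Operators (N : ℕ) where
  open PathGrid N public

  parity-left : ∀ {s f} → HasParity s f → HasParity (- s) (left f)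
  parity-left {s} {f} pf i j = begin
    ε i * ε j * left f i j
      ≡⟨ solve 2 (λ e x → e :* x := :- (:- (e :* x))) refl (ε i * ε j) (left f i j) ⟩
    - - (ε i * ε j * left f i j)
      ≡⟨ cong (λ x → - - x) (ℚ.*-assoc (ε i) (ε j) (left f i j)) ⟩
    - - (ε i * (ε j * left f i j))
      ≡⟨ cong (λ x → - - (ε i * x)) (A*-*ˡ (ε j) (λ a → f a j) i) ⟨
    - - (ε i * A* (λ a → ε j * f a j) i)
      ≡⟨ cong -_ (A*-ε (λ a → ε j * f a j) i) ⟨
    - A* (λ a → ε a * (ε j * f a j)) i
      ≡⟨ cong -_ (A*-cong (λ {a} _ → trans (sym (ℚ.*-assoc (ε a) (ε j) (f a j))) (pf a j)) i) ⟩
    - A* (λ a → s * f a j) i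
      ≡⟨ cong -_ (A*-*ˡ s (λ a → f a j) i) ⟩
    - (s * left f i j)
      ≡⟨ ℚ.neg-distribˡ-* s (left f i j) ⟩
    - s * left f i j ∎
    where open ≡-Reasoning

  parity-right : ∀ {s f} → HasParity s f → HasParity (- s) (right f)
  parity-right {s} {f} pf = parity-flip { - s} {left (flip f)}
    (parity-left {s} {flip f} (parity-flip {s} {f} pf))

  -- diamond f, anticommutator f and commutator f are A f A, A f + f A
  -- and A f − f A, where A is the adjacency matrix of the path.
  diamond anticommutator commutator squareCommutator : Grid → Grid
  diamond f          = left (right f)
  anticommutator f   = left f ⊕ right f
  commutator f       = left f ⊖ right f
  squareCommutator f = left (left f) ⊖ right (right f)

  left-pointwise : ∀ {f g} → (∀ i j → f i j ≡ g i j) → ∀ i j → left f i j ≡ left g i j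
  left-pointwise f≡g i j = A*-cong (λ {a} _ → f≡g a j) i

  right-pointwise : ∀ {f g} → (∀ i j → f i j ≡ g i j) → ∀ i j → right f i j ≡ right g i j
  right-pointwise f≡g i j = A*-cong (λ {b} _ → f≡g i b) j

  left-⊕ : ∀ f g i j → left (f ⊕ g) i j ≡ left f i j + left g i j
  left-⊕ f g i j = A*-plus (λ a → f a j) (λ a → g a j) i

  right-⊕ : ∀ f g i j → right (f ⊕ g) i j ≡ right f i j + right g i j
  right-⊕ f g i j = A*-plus (f i) (g i) j

  diamond-⊕ : ∀ f g i j → diamond (f ⊕ g) i j ≡ diamond f i j + diamond g i j
  diamond-⊕ f g i j = trans (left-pointwise {right (f ⊕ g)} {right f ⊕ right g} (right-⊕ f g) i j)
                            (left-⊕ (right f) (right g) i j)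

  diamond-⊖ : ∀ f g i j → diamond (f ⊖ g) i j ≡ diamond f i j - diamond g i j
  diamond-⊖ f g i j = trans (left-pointwise {right (f ⊖ g)} {right f ⊖ right g} (right-⊖ f g) i j)
                            (left-⊖ (right f) (right g) i j)

  -- Left and right multiplications commute with each other, hence `diamond` commutes with every
  -- expression built from them. This is what makes the commutators below compatible with the
  -- action.
  diamond-left : ∀ f i j → left (diamond f) i j ≡ diamond (left f) i j
  diamond-left f = left-pointwise {left (right f)} {right (left f)} (left-right f)

  diamond-right : ∀ f i j → right (diamond f) i j ≡ diamond (right f) i j
  diamond-right f i j = sym (left-right (right f) i j)

  diamond-anticommutator : ∀ f i j →
    anticommutator (diamond f) i j ≡ diamond (anticommutator f) i j
  diamond-anticommutator f i j = trans (cong₂ _+_ (diamond-left f i j) (diamond-right f i j))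
                                       (sym (diamond-⊕ (left f) (right f) i j))

  diamond-commutator : ∀ f i j → commutator (diamond f) i j ≡ diamond (commutator f) i j
  diamond-commutator f i j = trans (cong₂ _-_ (diamond-left f i j) (diamond-right f i j))
                                   (sym (diamond-⊖ (left f) (right f) i j))

  diamond-squareCommutator : ∀ f i j →
    squareCommutator (diamond f) i j ≡ diamond (squareCommutator f) i j
  diamond-squareCommutator f i j = trans
    (cong₂ _-_ (trans (left-pointwise {left (diamond f)} {diamond (left f)} (diamond-left f) i j)
      (diamond-left (left f) i j))
               (trans (right-pointwise {right (diamond f)} {diamond (right f)} (diamond-right f) i
                 j) (diamond-right (right f) i j)))
    (sym (diamond-⊖ (left (left f)) (right (right f)) i j))

  left-twist : ∀ f i j → left (twist f) i j ≡ twist (left f) i j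
  left-twist f i j = A*-*ˡ (ε j) (λ a → f a j) i

  right-twist : ∀ f i j → right (twist f) i j ≡ - twist (right f) i j
  right-twist f i j = A*-ε (f i) j

  -- The twist passes through the left factor unchanged and anticommutes with the right one. The
  -- resulting sign is the source of the negative loops in `Q′`.
  diamond-twist : ∀ f i j → diamond (twist f) i j ≡ - twist (diamond f) i j
  diamond-twist f i j = begin
    A* (λ a → right (twist f) a j) i
      ≡⟨ A*-cong (λ {a} _ → trans (right-twist f a j) (ℚ.neg-distribˡ-* (ε j) (right f a j))) i ⟩
    A* (λ a → - ε j * right f a j) i  ≡⟨ A*-*ˡ (- ε j) (λ a → right f a j) i ⟩
    - ε j * diamond f i j             ≡⟨ ℚ.neg-distribˡ-* (ε j) (diamond f i j) ⟨
    - (ε j * diamond f i j)           ∎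
    where open ≡-Reasoning

  parity-squareCommutator : ∀ {f} → HasParity 1ℚ f → HasParity 1ℚ (squareCommutator f)
  parity-squareCommutator {f} pf = parity-⊖ {1ℚ} {left (left f)} {right (right f)}
    (parity-left { - 1ℚ} {left f} (parity-left {1ℚ} {f} pf))
    (parity-right { - 1ℚ} {right f} (parity-right {1ℚ} {f} pf))

  squares-agree : ∀ {f} → (∀ {i j} → i < N → j < N → squareCommutator f i j ≡ 0ℚ) →
                  left (left f) ≈ right (right f)
  squares-agree sq≡0 i<N j<N = minus≡0⇒≡ (sq≡0 i<N j<N)

  -- In A (A f + f A) - (A f + f A) A the terms A f A cancel, leaving A² f - f A².
  anticommutator-commutes : ∀ {f} → left (left f) ≈ right (right f) → Commutes (anticommutator f)
  anticommutator-commutes {f} eq {i} {j} i<N j<N = begin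
    left (anticommutator f) i j                    ≡⟨ left-⊕ (left f) (right f) i j ⟩
    left (left f) i j + left (right f) i j         ≡⟨ cong₂ _+_ (eq i<N j<N) (left-right f i j) ⟩
    right (right f) i j + right (left f) i j      
      ≡⟨ ℚ.+-comm (right (right f) i j) (right (left f) i j) ⟩
    right (left f) i j + right (right f) i j       ≡⟨ right-⊕ (left f) (right f) i j ⟨
    right (anticommutator f) i j                   ∎
    where open ≡-Reasoning

  -- Here A (A f - f A) + (A f - f A) A equals A² f - f A², so the commutator anticommutes with A;
  -- the twist turns this into commutation.
  twisted-commutator-commutes : ∀ {f} → left (left f) ≈ right (right f) →
                                Commutes (twist (commutator f))
  twisted-commutator-commutes {f} eq {i} {j} i<N j<N = begin
    left (twist (commutator f)) i j              ≡⟨ left-twist (commutator f) i j ⟩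
    ε j * left (commutator f) i j
      ≡⟨ cong (ε j *_) (trans (left-⊖ (left f) (right f) i j)
           (cong₂ _-_ (eq i<N j<N) (left-right f i j))) ⟩
    ε j * (right (right f) i j - right (left f) i j)
      ≡⟨ solve 3 (λ e x y → e :* (x :- y) := :- (e :* (y :- x))) refl (ε j) (right (right f) i j)
           (right (left f) i j) ⟩
    - (ε j * (right (left f) i j - right (right f) i j))
      ≡⟨ cong (λ x → - (ε j * x)) (right-⊖ (left f) (right f) i j) ⟨
    - (ε j * right (commutator f) i j)           ≡⟨ right-twist (commutator f) i j ⟨
    right (twist (commutator f)) i j             ∎
    where open ≡-Reasoning

  -- A maps each `W` to the sum of its two neighbours. Two steps return to the start in two ways,
  -- and this coefficient 2 becomes the loop weight of `Q`.
  left-left-W : ∀ k i j → left (left (W (2 ℕ.+ k))) i j ≡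
                W (4 ℕ.+ k) i j + 2ℚ * W (2 ℕ.+ k) i j + W k i j
  left-left-W k i j = begin
    left (left (W (2 ℕ.+ k))) i j
      ≡⟨ left-pointwise {left (W (2 ℕ.+ k))} {W (3 ℕ.+ k) ⊕ W (1 ℕ.+ k)}
           (λ i j → rearrange (left (W (2 ℕ.+ k)) i j) (W (1 ℕ.+ k) i j)) i j ⟩
    left (W (3 ℕ.+ k) ⊕ W (1 ℕ.+ k)) i j
      ≡⟨ left-⊕ (W (3 ℕ.+ k)) (W (1 ℕ.+ k)) i j ⟩
    left (W (3 ℕ.+ k)) i j + left (W (1 ℕ.+ k)) i j
      -- Both `x :- w` and `u :- v` are values of `W` by definition, namely at `4 + k` and `2 + k`;
      -- the last summand is therefore a zero.
      ≡⟨ solve 4 (λ x u w v → x :+ u := (x :- w) :+ con 2ℚ :* w :+ v :+ ((u :- v) :- w)) refl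
           (left (W (3 ℕ.+ k)) i j) (left (W (1 ℕ.+ k)) i j) (W (2 ℕ.+ k) i j) (W k i j) ⟩
    W (4 ℕ.+ k) i j + 2ℚ * W (2 ℕ.+ k) i j + W k i j + (W (2 ℕ.+ k) i j - W (2 ℕ.+ k) i j)
      ≡⟨ solve 2 (λ x y → x :+ (y :- y) := x) refl
           (W (4 ℕ.+ k) i j + 2ℚ * W (2 ℕ.+ k) i j + W k i j) (W (2 ℕ.+ k) i j) ⟩
    W (4 ℕ.+ k) i j + 2ℚ * W (2 ℕ.+ k) i j + W k i j ∎
    where
    open ≡-Reasoning
    rearrange : ∀ x y → x ≡ x - y + y
    rearrange = solve 2 (λ x y → x := x :- y :+ y) refl

  -- Self-adjointness moves both copies of A onto the polynomial, where they merge into A² because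
  -- the polynomial commutes with A.
  ⟨W,diamond⟩ : ∀ k f → ⟨ W (2 ℕ.+ k) , diamond f ⟩ ≡
                ⟨ W (4 ℕ.+ k) , f ⟩ + 2ℚ * ⟨ W (2 ℕ.+ k) , f ⟩ + ⟨ W k , f ⟩
  ⟨W,diamond⟩ k f = begin
    ⟨ W (2 ℕ.+ k) , left (right f) ⟩    ≡⟨ left-selfAdjoint (W (2 ℕ.+ k)) (right f) ⟩
    ⟨ left (W (2 ℕ.+ k)) , right f ⟩    ≡⟨ right-selfAdjoint (left (W (2 ℕ.+ k))) f ⟩
    ⟨ right (left (W (2 ℕ.+ k))) , f ⟩
      ≡⟨ ⟨⟩-cong {right (left (W (2 ℕ.+ k)))} {W (4 ℕ.+ k) ⊕ 2ℚ ⊛ W (2 ℕ.+ k) ⊕ W k} {f} {f}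
           (λ {i} {j} i<N j<N → trans (sym (commutes-left {W (2 ℕ.+ k)} (commutes-W (2 ℕ.+ k)) i<N
             j<N))
                                      (left-left-W k i j)) (λ _ _ → refl) ⟩
    ⟨ W (4 ℕ.+ k) ⊕ 2ℚ ⊛ W (2 ℕ.+ k) ⊕ W k , f ⟩
      ≡⟨ ⟨⟩-⊕ˡ (W (4 ℕ.+ k) ⊕ 2ℚ ⊛ W (2 ℕ.+ k)) (W k) f ⟩
    ⟨ W (4 ℕ.+ k) ⊕ 2ℚ ⊛ W (2 ℕ.+ k) , f ⟩ + ⟨ W k , f ⟩
      ≡⟨ cong (_+ ⟨ W k , f ⟩) (trans (⟨⟩-⊕ˡ (W (4 ℕ.+ k)) (2ℚ ⊛ W (2 ℕ.+ k)) f)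
           (cong (⟨ W (4 ℕ.+ k) , f ⟩ +_) (⟨⟩-⊛ˡ 2ℚ (W (2 ℕ.+ k)) f))) ⟩
    ⟨ W (4 ℕ.+ k) , f ⟩ + 2ℚ * ⟨ W (2 ℕ.+ k) , f ⟩ + ⟨ W k , f ⟩ ∎
    where open ≡-Reasoning

-- The odd diamond as a matrix space

module OddGrid (n : ℕ) where
  N : ℕ
  N = suc (2 ℕ.* n)

  open Operators N public

  0<N : 0 < N
  0<N = z<s

  N≡ : N ≡ suc (n ℕ.* 2)
  N≡ = cong suc (ℕ.*-comm 2 n)

  -- The vector 1, 0, -1, 0, ... spans the kernel of the path on `N` vertices, and its outer square
  -- is a multiple of the orthogonal projection onto that kernel.
  zeroMode : Grid
  zeroMode i j = quarterCos i * quarterCos j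

  -- The right boundary condition holds because `N` is odd and the sequence vanishes at odd places.
  A*-quarterCos : ∀ {i} → i < N → A* quarterCos i ≡ 0ℚ
  A*-quarterCos {i} i<N = trans
    (A*-neighbours quarterCos i<N (λ 1+i≡N → trans (cong quarterCos (trans 1+i≡N N≡))
      (quarterCos-odd n)))
    (cancel i)
    where
    cancel : ∀ i → quarterCos (suc i) + previous quarterCos i ≡ 0ℚ
    cancel zero    = refl
    cancel (suc i) = ℚ.+-inverseˡ (quarterCos i)

  left-zeroMode : ∀ {i} j → i < N → left zeroMode i j ≡ 0ℚ
  left-zeroMode {i} j i<N = begin
    A* (λ a → quarterCos a * quarterCos j) i
      ≡⟨ A*-cong (λ {a} _ → ℚ.*-comm (quarterCos a) (quarterCos j)) i ⟩
    A* (λ a → quarterCos j * quarterCos a) i ≡⟨ A*-*ˡ (quarterCos j) quarterCos i ⟩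
    quarterCos j * A* quarterCos i           ≡⟨ cong (quarterCos j *_) (A*-quarterCos i<N) ⟩
    quarterCos j * 0ℚ                        ≡⟨ ℚ.*-zeroʳ (quarterCos j) ⟩
    0ℚ                                       ∎
    where open ≡-Reasoning

  right-zeroMode : ∀ i {j} → j < N → right zeroMode i j ≡ 0ℚ
  right-zeroMode i {j} j<N = begin
    A* (λ b → quarterCos i * quarterCos b) j ≡⟨ A*-*ˡ (quarterCos i) quarterCos j ⟩
    quarterCos i * A* quarterCos j           ≡⟨ cong (quarterCos i *_) (A*-quarterCos j<N) ⟩
    quarterCos i * 0ℚ                        ≡⟨ ℚ.*-zeroʳ (quarterCos i) ⟩
    0ℚ                                       ∎
    where open ≡-Reasoning

  ⟨zeroMode,diamond⟩ : ∀ f → ⟨ zeroMode , diamond f ⟩ ≡ 0ℚ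
  ⟨zeroMode,diamond⟩ f = begin
    ⟨ zeroMode , left (right f) ⟩  ≡⟨ left-selfAdjoint zeroMode (right f) ⟩
    ⟨ left zeroMode , right f ⟩
      ≡⟨ ∑-zero N (λ {i} i<N → ∑-zero N (λ {j} _ →
           trans (cong (_* right f i j) (left-zeroMode j i<N)) (ℚ.*-zeroˡ (right f i j)))) ⟩
    0ℚ ∎
    where open ≡-Reasoning

  -- The index `suc k * 2` selects the Chebyshev polynomial U of odd index 2k + 1; with the factor 2
  -- on the right, it reduces to `2 + k * 2`, the form in which the recurrence applies.
  ⟨W,-⟩ : Grid → ℕ → ℚ
  ⟨W,-⟩ g k = ⟨ W (suc k ℕ.* 2) , g ⟩

  -- At `k = n` the index is `suc N`, that of the vanishing characteristic polynomial. This is where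
  -- the path underlying `Q n` ends on the right.
  ⟨W,-⟩-end : ∀ g → ⟨W,-⟩ g n ≡ 0ℚ
  ⟨W,-⟩-end g = ∑-zero N (λ {i} i<N → ∑-zero N (λ {j} j<N → trans
    (cong (_* g i j) (trans (cong (λ k → W k i j) (cong suc (sym N≡))) (W-end 0<N i<N j<N)))
    (ℚ.*-zeroˡ (g i j))))

  ⟨W,-⟩-previous : ∀ g k → ⟨ W (k ℕ.* 2) , g ⟩ ≡ previous (⟨W,-⟩ g) k
  ⟨W,-⟩-previous g zero    = ∑-zero N (λ {i} _ → ∑-zero N (λ {j} _ → ℚ.*-zeroˡ (g i j)))
  ⟨W,-⟩-previous g (suc k) = refl

  ∑-path+loop : ∀ c (x : ℕ → ℚ) {k} → k < n → x n ≡ 0ℚ →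
    ∑ n (λ k′ → (path k k′ + c * δ k k′) * x k′) ≡ x (suc k) + previous x k + c * x k
  ∑-path+loop c x {k} k<n xn≡0 = begin
    ∑ n (λ a → (path k a + c * δ k a) * x a)
      ≡⟨ ∑-cong n (λ {a} _ → solve 4 (λ p c d x → (p :+ c :* d) :* x := p :* x :+ c :* (d :* x))
           refl
           (path k a) c (δ k a) (x a)) ⟩
    ∑ n (λ a → path k a * x a + c * (δ k a * x a))
      ≡⟨ ∑-+ n (λ a → path k a * x a) (λ a → c * (δ k a * x a)) ⟩
    ∑ n (λ a → path k a * x a) + ∑ n (λ a → c * (δ k a * x a))
      ≡⟨ cong₂ _+_
           (PathGrid.A*-neighbours n x k<n (λ 1+k≡n → trans (cong x 1+k≡n) xn≡0))
           (trans (∑-*ˡ n c (λ a → δ k a * x a)) (cong (c *_) (∑-δ x k<n))) ⟩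
    x (suc k) + previous x k + c * x k ∎
    where open ≡-Reasoning

  ⟨W,diamond⟩-step : ∀ g k → ⟨W,-⟩ (diamond g) k ≡
    ⟨W,-⟩ g (suc k) + previous (⟨W,-⟩ g) k + 2ℚ * ⟨W,-⟩ g k
  ⟨W,diamond⟩-step g k = begin
    ⟨W,-⟩ (diamond g) k
      ≡⟨ ⟨W,diamond⟩ (k ℕ.* 2) g ⟩
    ⟨W,-⟩ g (suc k) + 2ℚ * ⟨W,-⟩ g k + ⟨ W (k ℕ.* 2) , g ⟩
      ≡⟨ cong (⟨W,-⟩ g (suc k) + 2ℚ * ⟨W,-⟩ g k +_) (⟨W,-⟩-previous g k) ⟩
    ⟨W,-⟩ g (suc k) + 2ℚ * ⟨W,-⟩ g k + previous (⟨W,-⟩ g) k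
      ≡⟨ solve 3 (λ x y z → x :+ y :+ z := x :+ z :+ y) refl
           (⟨W,-⟩ g (suc k)) (2ℚ * ⟨W,-⟩ g k) (previous (⟨W,-⟩ g) k) ⟩
    ⟨W,-⟩ g (suc k) + previous (⟨W,-⟩ g) k + 2ℚ * ⟨W,-⟩ g k ∎
    where open ≡-Reasoning

  -- The factor ε k conjugates -(A + 2), for the path A on n vertices, into A - 2.
  loopMode loopMode′ : Grid → ℕ → ℚ
  loopMode  f k = ⟨W,-⟩ (anticommutator f) k
  loopMode′ f k = ε k * ⟨W,-⟩ (twist (commutator f)) k

  ⟨W,-⟩-cong : ∀ {f g} → f ≈ g → ∀ k → ⟨W,-⟩ f k ≡ ⟨W,-⟩ g k
  ⟨W,-⟩-cong {f} {g} f≈g k = ⟨⟩-cong {W (suc k ℕ.* 2)} {W (suc k ℕ.* 2)} {f} {g} (λ _ _ → refl)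
    f≈g

  loopMode-diamond : ∀ f {k} → k < n →
    loopMode (diamond f) k ≡ ∑ n (λ k′ → (path k k′ + 2ℚ * δ k k′) * loopMode f k′)
  loopMode-diamond f {k} k<n = begin
    ⟨W,-⟩ (anticommutator (diamond f)) k
      ≡⟨ ⟨W,-⟩-cong {anticommutator (diamond f)} {diamond g}
           (λ {i} {j} _ _ → diamond-anticommutator f i j) k ⟩
    ⟨W,-⟩ (diamond g) k
      ≡⟨ ⟨W,diamond⟩-step g k ⟩
    ⟨W,-⟩ g (suc k) + previous (⟨W,-⟩ g) k + 2ℚ * ⟨W,-⟩ g k
      ≡⟨ ∑-path+loop 2ℚ (loopMode f) k<n (⟨W,-⟩-end g) ⟨
    ∑ n (λ k′ → (path k k′ + 2ℚ * δ k k′) * loopMode f k′) ∎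
    where
    open ≡-Reasoning
    g : Grid
    g = anticommutator f

  loopMode′-diamond : ∀ f {k} → k < n →
    loopMode′ (diamond f) k ≡ ∑ n (λ k′ → (path k k′ + - 2ℚ * δ k k′) * loopMode′ f k′)
  loopMode′-diamond f {k} k<n = begin
    ε k * ⟨W,-⟩ (twist (commutator (diamond f))) k
      ≡⟨ cong (ε k *_) (⟨W,-⟩-cong {twist (commutator (diamond f))} {(- 1ℚ) ⊛ diamond g} twisted
           k) ⟩
    ε k * ⟨W,-⟩ ((- 1ℚ) ⊛ diamond g) k
      ≡⟨ cong (ε k *_) (⟨⟩-⊛ʳ (- 1ℚ) (W (suc k ℕ.* 2)) (diamond g)) ⟩
    ε k * (- 1ℚ * ⟨W,-⟩ (diamond g) k)
      ≡⟨ cong (λ x → ε k * (- 1ℚ * x)) (⟨W,diamond⟩-step g k) ⟩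
    ε k * (- 1ℚ * (⟨W,-⟩ g (suc k) + previous (⟨W,-⟩ g) k + 2ℚ * ⟨W,-⟩ g k))
      -- The factor `- ε k` is the sign belonging to either neighbour of `k`, so the edge terms
      -- absorb the minus and only the loop term keeps it.
      ≡⟨ solve 4 (λ e x y z → e :* (con (- 1ℚ) :* (x :+ y :+ con 2ℚ :* z)) :=
                   (:- e) :* x :+ (:- e) :* y :+ con (- 2ℚ) :* (e :* z)) refl
           (ε k) (⟨W,-⟩ g (suc k)) (previous (⟨W,-⟩ g) k) (⟨W,-⟩ g k) ⟩
    loopMode′ f (suc k) + - ε k * previous (⟨W,-⟩ g) k + - 2ℚ * loopMode′ f k
      ≡⟨ cong (λ x → loopMode′ f (suc k) + x + - 2ℚ * loopMode′ f k) (previous-ε k) ⟩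
    loopMode′ f (suc k) + previous (loopMode′ f) k + - 2ℚ * loopMode′ f k
      ≡⟨ ∑-path+loop (- 2ℚ) (loopMode′ f) k<n
           (trans (cong (ε n *_) (⟨W,-⟩-end g)) (ℚ.*-zeroʳ (ε n))) ⟨
    ∑ n (λ k′ → (path k k′ + - 2ℚ * δ k k′) * loopMode′ f k′) ∎
    where
    open ≡-Reasoning
    g : Grid
    g = twist (commutator f)
    twisted : ∀ {i j} → i < N → j < N → twist (commutator (diamond f)) i j ≡ - 1ℚ * diamond g i j
    twisted {i} {j} _ _ = begin
      ε j * commutator (diamond f) i j   ≡⟨ cong (ε j *_) (diamond-commutator f i j) ⟩
      ε j * diamond (commutator f) i j
        ≡⟨ solve 1 (λ x → x := con (- 1ℚ) :* (:- x)) refl (ε j * diamond (commutator f) i j) ⟩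
      - 1ℚ * - (ε j * diamond (commutator f) i j)
        ≡⟨ cong (- 1ℚ *_) (diamond-twist (commutator f) i j) ⟨
      - 1ℚ * diamond g i j ∎
    ⟨⟩-⊛ʳ : ∀ c f g → ⟨ f , c ⊛ g ⟩ ≡ c * ⟨ f , g ⟩
    ⟨⟩-⊛ʳ c f g = begin
      ⟨ f , c ⊛ g ⟩  ≡⟨ ∑-cong² N N (λ {i} {j} _ _ → ℚ.*-comm (f i j) (c * g i j)) ⟩
      ⟨ c ⊛ g , f ⟩  ≡⟨ ⟨⟩-⊛ˡ c g f ⟩
      c * ⟨ g , f ⟩  ≡⟨ cong (c *_) (∑-cong² N N (λ {i} {j} _ _ → ℚ.*-comm (g i j) (f i j))) ⟩
      c * ⟨ f , g ⟩  ∎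
    previous-ε : ∀ k → - ε k * previous (⟨W,-⟩ g) k ≡ previous (loopMode′ f) k
    previous-ε zero    = refl
    previous-ε (suc k) = cong (_* ⟨W,-⟩ g k) (neg-involutive (ε k))

  ε-cancel : ∀ k {x} → ε k * x ≡ 0ℚ → x ≡ 0ℚ
  ε-cancel k {x} εx≡0 = begin
    x                ≡⟨ ℚ.*-identityˡ x ⟨
    1ℚ * x           ≡⟨ cong (_* x) (ε² k) ⟨
    ε k * ε k * x    ≡⟨ ℚ.*-assoc (ε k) (ε k) x ⟩
    ε k * (ε k * x)  ≡⟨ cong (ε k *_) εx≡0 ⟩
    ε k * 0ℚ         ≡⟨ ℚ.*-zeroʳ (ε k) ⟩
    0ℚ               ∎
    where open ≡-Reasoning

  -- Only odd columns of the first row can be nonzero, and there the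
  -- corresponding W has even index.
  odd-commutes-orthogonal : ∀ {f} → HasParity (- 1ℚ) f → Commutes f →
    (∀ {k} → k < n → ⟨W,-⟩ f k ≡ 0ℚ) → ∀ {i j} → i < N → j < N → f i j ≡ 0ℚ
  odd-commutes-orthogonal {f} pf cf f⊥W = commutes-orthogonal 0<N f cf term≡0
    where
    term≡0 : ∀ {k} → k < N → f 0 k * ⟨ W (suc k) , f ⟩ ≡ 0ℚ
    term≡0 {k} k<N with even-or-odd k
    ... | inj₁ 2∣k = trans (cong (_* ⟨ W (suc k) , f ⟩) (oddGrid-vanishes {f} pf 2∣k))
                           (ℚ.*-zeroˡ ⟨ W (suc k) , f ⟩)
    ... | inj₂ (divides (suc l) 1+k≡2+2l) = trans
      (cong (f 0 k *_) (trans (cong (λ m → ⟨ W m , f ⟩) 1+k≡2+2l) (f⊥W l<n)))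
      (ℚ.*-zeroʳ (f 0 k))
      where
      l<n : l < n
      l<n = ℕ.*-cancelʳ-< 2 l n (subst (_≤ n ℕ.* 2) (ℕ.suc-injective 1+k≡2+2l)
              (s≤s⁻¹ (subst (k <_) N≡ k<N)))

  annihilated-by-path : ∀ {f} → (∀ {i j} → i < N → j < N → left f i j ≡ 0ℚ) →
    (∀ {i j} → i < N → j < N → right f i j ≡ 0ℚ) → ⟨ zeroMode , f ⟩ ≡ 0ℚ →
    ∀ {i j} → i < N → j < N → f i j ≡ 0ℚ
  annihilated-by-path {f} lf≡0 rf≡0 zf≡0 = ⟨⟩-definite f (begin
    ⟨ f , f ⟩
      ≡⟨ ⟨⟩-cong {f} {f 0 0 ⊛ zeroMode} {f} {f} (λ i<N j<N → minus≡0⇒≡ (g≡0 i<N j<N))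
           (λ _ _ → refl) ⟩
    ⟨ f 0 0 ⊛ zeroMode , f ⟩  ≡⟨ ⟨⟩-⊛ˡ (f 0 0) zeroMode f ⟩
    f 0 0 * ⟨ zeroMode , f ⟩  ≡⟨ cong (f 0 0 *_) zf≡0 ⟩
    f 0 0 * 0ℚ                ≡⟨ ℚ.*-zeroʳ (f 0 0) ⟩
    0ℚ                        ∎)
    where
    open ≡-Reasoning
    g : Grid
    -- The coefficient is read off at the corner, where `zeroMode` has the value 1.
    g = f ⊖ f 0 0 ⊛ zeroMode
    g00≡0 : g 0 0 ≡ 0ℚ
    g00≡0 = solve 1 (λ x → x :- x :* (con 1ℚ :* con 1ℚ) := con 0ℚ) refl (f 0 0)
    scaled-zero : ∀ {x y} → x ≡ 0ℚ → y ≡ 0ℚ → x - f 0 0 * y ≡ 0ℚ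
    scaled-zero refl refl = solve 1 (λ c → con 0ℚ :- c :* con 0ℚ := con 0ℚ) refl (f 0 0)
    lg≡0 : ∀ {i j} → i < N → j < N → left g i j ≡ 0ℚ
    lg≡0 {i} {j} i<N j<N = begin
      left g i j                                        ≡⟨ left-⊖ f (f 0 0 ⊛ zeroMode) i j ⟩
      left f i j - left (f 0 0 ⊛ zeroMode) i j
        ≡⟨ cong (λ x → left f i j - x) (A*-*ˡ (f 0 0) (λ a → zeroMode a j) i) ⟩
      left f i j - f 0 0 * left zeroMode i j
        ≡⟨ scaled-zero (lf≡0 i<N j<N) (left-zeroMode j i<N) ⟩
      0ℚ ∎
    rg≡0 : ∀ {i j} → i < N → j < N → right g i j ≡ 0ℚ
    rg≡0 {i} {j} i<N j<N = begin
      right g i j                                       ≡⟨ right-⊖ f (f 0 0 ⊛ zeroMode) i j ⟩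
      right f i j - right (f 0 0 ⊛ zeroMode) i j
        ≡⟨ cong (λ x → right f i j - x) (A*-*ˡ (f 0 0) (zeroMode i) j) ⟩
      right f i j - f 0 0 * right zeroMode i j
        ≡⟨ scaled-zero (rf≡0 i<N j<N) (right-zeroMode i j<N) ⟩
      0ℚ ∎
    g≡0 : ∀ {i j} → i < N → j < N → g i j ≡ 0ℚ
    -- The inner use of `A*-kernel` runs along row 0 from the corner; the outer one runs down column
    -- `j` from row 0.
    g≡0 {i} {j} i<N j<N = A*-kernel (λ a → g a j)
      (A*-kernel (g 0) g00≡0 (rg≡0 0<N) j<N) (λ i<N → lg≡0 i<N j<N) i<N

  even-modes-determine : ∀ {f} → HasParity 1ℚ f →
    (∀ {i j} → i < N → j < N → squareCommutator f i j ≡ 0ℚ) →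
    ⟨ zeroMode , f ⟩ ≡ 0ℚ →
    (∀ {k} → k < n → loopMode f k ≡ 0ℚ) →
    (∀ {k} → k < n → loopMode′ f k ≡ 0ℚ) →
    ∀ {i j} → i < N → j < N → f i j ≡ 0ℚ
  even-modes-determine {f} pf sq≡0 zero≡0 loop≡0 loop′≡0 =
    annihilated-by-path {f} lf≡0 rf≡0 zero≡0
    where
    open ≡-Reasoning
    lf-parity : HasParity (- 1ℚ) (left f)
    lf-parity = parity-left {1ℚ} {f} pf
    rf-parity : HasParity (- 1ℚ) (right f)
    rf-parity = parity-right {1ℚ} {f} pf
    anti≡0 : ∀ {i j} → i < N → j < N → left f i j + right f i j ≡ 0ℚ
    anti≡0 = odd-commutes-orthogonal {anticommutator f}
      (parity-⊕ { - 1ℚ} {left f} {right f} lf-parity rf-parity)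
      (anticommutator-commutes {f} (squares-agree {f} sq≡0)) loop≡0
    twisted≡0 : ∀ {i j} → i < N → j < N → twist (commutator f) i j ≡ 0ℚ
    twisted≡0 = odd-commutes-orthogonal {twist (commutator f)}
      (parity-twist { - 1ℚ} {commutator f} (parity-⊖ { - 1ℚ} {left f} {right f} lf-parity
        rf-parity))
      (twisted-commutator-commutes {f} (squares-agree {f} sq≡0))
      (λ {k} k<n → ε-cancel k (loop′≡0 k<n))
    comm≡0 : ∀ {i j} → i < N → j < N → left f i j - right f i j ≡ 0ℚ
    comm≡0 {i} {j} i<N j<N = ε-cancel j (twisted≡0 i<N j<N)
    lf≡0 : ∀ {i j} → i < N → j < N → left f i j ≡ 0ℚ
    lf≡0 {i} {j} i<N j<N = double≡0 (left f i j) (begin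
      left f i j + left f i j
        ≡⟨ solve 2 (λ x y → x :+ x := (x :+ y) :+ (x :- y)) refl (left f i j) (right f i j) ⟩
      (left f i j + right f i j) + (left f i j - right f i j)
        ≡⟨ cong₂ _+_ (anti≡0 i<N j<N) (comm≡0 i<N j<N) ⟩
      0ℚ ∎)
    rf≡0 : ∀ {i j} → i < N → j < N → right f i j ≡ 0ℚ
    rf≡0 i<N j<N = trans (sym (minus≡0⇒≡ (comm≡0 i<N j<N))) (lf≡0 i<N j<N)

-- The halved diamond

if-dec : ∀ {P A : Set} (P? : Dec P) {x y z : A} → (P → y ≡ x) → (¬ P → z ≡ x) →
         (if does P? then y else z) ≡ x
if-dec (yes p) y≡x z≡x = y≡x p
if-dec (no ¬p) y≡x z≡x = z≡x ¬p

path-distance : ∀ i j → path i j ≡ δ 1 ∣ i - j ∣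
path-distance zero    zero          = refl
path-distance zero    (suc zero)    = refl
path-distance zero    (suc (suc j)) = refl
path-distance (suc zero)    zero    = refl
path-distance (suc (suc i)) zero    = refl
path-distance (suc i) (suc j)       = path-distance i j

distance≢1⇒path≡0 : ∀ {i j} → ∣ i - j ∣ ≢ 1 → path i j ≡ 0ℚ
distance≢1⇒path≡0 {i} {j} d≢1 = trans (path-distance i j) (δ-≢ (d≢1 ∘ sym))

distance≡1⇒path≡1 : ∀ {i j} → ∣ i - j ∣ ≡ 1 → path i j ≡ 1ℚ
distance≡1⇒path≡1 {i} {j} d≡1 = trans (path-distance i j) (cong (δ 1) d≡1)

distance≡1⇒neighbours : ∀ i j → ∣ i - j ∣ ≡ 1 → suc i ≡ j ⊎ suc j ≡ i
distance≡1⇒neighbours zero    (suc zero) _  = inj₁ refl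
distance≡1⇒neighbours (suc zero) zero    _  = inj₂ refl
distance≡1⇒neighbours (suc i) (suc j) d≡1 with distance≡1⇒neighbours i j d≡1
... | inj₁ 1+i≡j = inj₁ (cong suc 1+i≡j)
... | inj₂ 1+j≡i = inj₂ (cong suc 1+j≡i)

path-non-neighbours : ∀ {i j} → ¬ (suc i ≡ j ⊎ suc j ≡ i) → path i j ≡ 0ℚ
path-non-neighbours {i} {j} ¬nb = distance≢1⇒path≡0 {i} {j} (¬nb ∘ distance≡1⇒neighbours i j)

path-above : ∀ {i j} → suc i < j → path i j ≡ 0ℚ
path-above 1+i<j = path-non-neighbours λ
  { (inj₁ 1+i≡j) → ℕ.<⇒≢ 1+i<j 1+i≡j
  ; (inj₂ refl)  → ℕ.<⇒≱ 1+i<j (ℕ.m≤n⇒m≤1+n (ℕ.n≤1+n _)) }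

path-below : ∀ {i j} → suc j < i → path i j ≡ 0ℚ
path-below {i} {j} 1+j<i = trans (path-sym i j) (path-above 1+j<i)

-- A support at least two places above the diagonal leaves columns 0 and 1 and the last two rows
-- empty, so shifting the columns by 2 fits it into the smaller board.
∑-farAboveDiagonal : ∀ M (X : ℕ → ℕ → ℚ) → (∀ a b → ¬ 2 ℕ.+ a ≤ b → X a b ≡ 0ℚ) →
  ∑ (2 ℕ.+ M) (λ a → ∑ (2 ℕ.+ M) (X a)) ≡ ∑ M (λ a → ∑ M (λ b → X a (2 ℕ.+ b)))
∑-farAboveDiagonal M X X≡0 = begin
  ∑ (2 ℕ.+ M) (λ a → ∑ (2 ℕ.+ M) (X a))
    ≡⟨ ∑-cong (2 ℕ.+ M) (λ {a} _ → dropTwo a) ⟩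
  ∑ (2 ℕ.+ M) F
    ≡⟨ ∑-last (suc M) F ⟩
  ∑ (suc M) F + F (suc M)
    ≡⟨ cong₂ _+_ (∑-last M F) (F≡0 (ℕ.n≤1+n M)) ⟩
  ∑ M F + F M + 0ℚ
    ≡⟨ cong (λ x → ∑ M F + x + 0ℚ) (F≡0 ℕ.≤-refl) ⟩
  ∑ M F + 0ℚ + 0ℚ
    ≡⟨ solve 1 (λ x → x :+ con 0ℚ :+ con 0ℚ := x) refl (∑ M F) ⟩
  ∑ M F ∎
  where
  open ≡-Reasoning
  F : ℕ → ℚ
  F a = ∑ M (λ b → X a (2 ℕ.+ b))
  dropTwo : ∀ a → X a 0 + (X a 1 + F a) ≡ F a
  dropTwo a = begin
    X a 0 + (X a 1 + F a)
      ≡⟨ cong₂ (λ x y → x + (y + F a)) (X≡0 a 0 (λ ())) (X≡0 a 1 (λ { (s≤s ()) })) ⟩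
    0ℚ + (0ℚ + F a)  ≡⟨ solve 1 (λ x → con 0ℚ :+ (con 0ℚ :+ x) := x) refl (F a) ⟩
    F a              ∎
  F≡0 : ∀ {a} → M ≤ a → F a ≡ 0ℚ
  F≡0 {a} M≤a = ∑-zero M (λ {b} b<M → X≡0 a (2 ℕ.+ b)
    (λ 2+a≤2+b → ℕ.<⇒≱ b<M (ℕ.≤-trans M≤a (s≤s⁻¹ (s≤s⁻¹ 2+a≤2+b)))))

-- The antisymmetric part of a grid function, read off at (i , j + 2): this
-- identifies the squares strictly above the diagonal of the larger
-- diamond with those on or above the diagonal of the smaller one.
difference : Grid → Grid
difference f i j = f i (2 ℕ.+ j) - f (2 ℕ.+ j) i

module Difference (m : ℕ) where
  M : ℕ
  M = suc (2 ℕ.* m)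

  open OddGrid (suc m) public

  N≡2+M : N ≡ 2 ℕ.+ M
  N≡2+M = cong suc (ℕ.*-suc 2 m)

  N>2+ : ∀ {j} → j < M → 2 ℕ.+ j < N
  N>2+ {j} j<M = subst (2 ℕ.+ j <_) (sym N≡2+M) (s<s (s<s j<M))

  N> : ∀ {j} → j < M → j < N
  N> {j} j<M = ℕ.<-trans (ℕ.<-trans (ℕ.n<1+n j) (ℕ.n<1+n (suc j))) (N>2+ j<M)

  module _ {f : Grid} (pf : HasParity 1ℚ f) where

    diamondTerm : ℕ → ℕ → ℕ → ℕ → ℚ
    diamondTerm i j a b = path i a * (path j b * (f a b - f b a))

    difference-odd : ∀ {a b} → 2 ∣ suc (a ℕ.+ b) → f a b - f b a ≡ 0ℚ
    difference-odd {a} {b} = evenGrid-vanishes {f ⊖ flip f}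
      (parity-⊖ {1ℚ} {f} {flip f} pf (parity-flip {1ℚ} {f} pf)) {a} {b}

    -- Squares with `b = a + 1` are white, and those on the diagonal cancel by antisymmetry. A
    -- square below the diagonal is out of reach: a neighbour of (i , j + 2) has
    -- `a ≤ i + 1 ≤ j + 1 ≤ b`. Hence the smaller diamond needs no correction along the diagonal.
    diamondTerm-vanishes : ∀ {i j} → i ≤ j → ∀ a b → ¬ 2 ℕ.+ a ≤ b →
      diamondTerm i (2 ℕ.+ j) a b ≡ 0ℚ
    diamondTerm-vanishes {i} {j} i≤j a b a+2≰b = vanish (ℕ.<-cmp a b)
      where
      thirdFactor : f a b - f b a ≡ 0ℚ → diamondTerm i (2 ℕ.+ j) a b ≡ 0ℚ
      thirdFactor d≡0 = trans (cong (λ x → path i a * (path (2 ℕ.+ j) b * x)) d≡0)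
        (solve 2 (λ p q → p :* (q :* con 0ℚ) := con 0ℚ) refl (path i a) (path (2 ℕ.+ j) b))
      vanish : _ → diamondTerm i (2 ℕ.+ j) a b ≡ 0ℚ
      vanish (tri< a<b _ _) = thirdFactor (difference-odd (subst (λ c → 2 ∣ suc (a ℕ.+ c))
        (ℕ.≤-antisym a<b (s≤s⁻¹ (ℕ.≰⇒> a+2≰b)))
        (subst (λ c → 2 ∣ suc c) (sym (ℕ.+-suc a a)) (2∣2+ (even[m+m] a)))))
      vanish (tri≈ _ refl _) = thirdFactor (ℚ.+-inverseʳ (f a a))
      vanish (tri> _ _ b<a) with a ℕ.≤? suc i
      ... | no a≰1+i = trans
        (cong (_* (path (2 ℕ.+ j) b * (f a b - f b a))) (path-above (ℕ.≰⇒> a≰1+i)))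
        (ℚ.*-zeroˡ (path (2 ℕ.+ j) b * (f a b - f b a)))
      ... | yes a≤1+i = begin
        path i a * (path (2 ℕ.+ j) b * (f a b - f b a))
          ≡⟨ cong (λ x → path i a * (x * (f a b - f b a)))
               (path-below (s≤s (s≤s (ℕ.≤-trans (s≤s⁻¹ (ℕ.≤-trans b<a a≤1+i)) i≤j)))) ⟩
        path i a * (0ℚ * (f a b - f b a))
          ≡⟨ solve 2 (λ p x → p :* (con 0ℚ :* x) := con 0ℚ) refl (path i a) (f a b - f b a) ⟩
        0ℚ ∎
        where open ≡-Reasoning

    difference-diamond-∑ : ∀ {i j} → i ≤ j →
      difference (diamond f) i j ≡ ∑ M (λ a → ∑ M (λ b → diamondTerm i (2 ℕ.+ j) a (2 ℕ.+ b)))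
    difference-diamond-∑ {i} {j} i≤j = begin
      -- Transposition exchanges `left` and `right`, so the second term is `diamond f (2 + j) i` by
      -- unfolding.
      diamond f i (2 ℕ.+ j) - right (left (flip f)) i (2 ℕ.+ j)
        ≡⟨ cong (λ x → diamond f i (2 ℕ.+ j) - x) (left-right (flip f) i (2 ℕ.+ j)) ⟨
      diamond f i (2 ℕ.+ j) - diamond (flip f) i (2 ℕ.+ j)
        ≡⟨ diamond-⊖ f (flip f) i (2 ℕ.+ j) ⟨
      ∑ N (λ a → path i a * ∑ N (λ b → path (2 ℕ.+ j) b * (f a b - f b a)))
        ≡⟨ ∑-cong N (λ {a} _ → sym (∑-*ˡ N (path i a) (λ b → path (2 ℕ.+ j) b * (f a b - f b a))))
             ⟩
      ∑ N (λ a → ∑ N (diamondTerm i (2 ℕ.+ j) a))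
        ≡⟨ cong (λ k → ∑ k (λ a → ∑ k (diamondTerm i (2 ℕ.+ j) a))) N≡2+M ⟩
      ∑ (2 ℕ.+ M) (λ a → ∑ (2 ℕ.+ M) (diamondTerm i (2 ℕ.+ j) a))
        ≡⟨ ∑-farAboveDiagonal M (diamondTerm i (2 ℕ.+ j)) (diamondTerm-vanishes i≤j) ⟩
      ∑ M (λ a → ∑ M (λ b → diamondTerm i (2 ℕ.+ j) a (2 ℕ.+ b))) ∎
      where open ≡-Reasoning

    -- The conditionals discard only terms that vanish anyway; they give the sum the shape of one
    -- over the filtered vertex list of `HOD`.
    difference-diamond : ∀ {i j} → i ≤ j →
      difference (diamond f) i j ≡ ∑ M (λ a → ∑ M (λ b →
        if does (2 ∣? (a ℕ.+ b))
        then (if does (a ℕ.≤? b) then path i a * path j b * difference f a b else 0ℚ)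
        else 0ℚ))
    difference-diamond {i} {j} i≤j = trans (difference-diamond-∑ i≤j)
      (∑-cong² M M (λ {a} {b} _ _ → sym (if-dec (2 ∣? (a ℕ.+ b))
        (λ _ → if-dec (a ℕ.≤? b)
          (λ _ → ℚ.*-assoc (path i a) (path j b) (difference f a b))
          (λ a≰b → sym (diamondTerm-vanishes i≤j a (2 ℕ.+ b)
            (λ 2+a≤2+b → a≰b (s≤s⁻¹ (s≤s⁻¹ 2+a≤2+b))))))
        (odd a b))))
      where
      odd : ∀ a b → ¬ 2 ∣ a ℕ.+ b → 0ℚ ≡ diamondTerm i (2 ℕ.+ j) a (2 ℕ.+ b)
      odd a b ¬even with even-or-odd (a ℕ.+ b)
      ... | inj₁ even = contradiction even ¬even
      ... | inj₂ 2∣1+a+b = sym (trans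
        (cong (λ x → path i a * (path j b * x)) (difference-odd (subst (λ c → 2 ∣ suc c)
          (sym (trans (ℕ.+-suc a (suc b)) (cong suc (ℕ.+-suc a b)))) (2∣2+ 2∣1+a+b))))
        (solve 2 (λ p q → p :* (q :* con 0ℚ) := con 0ℚ) refl (path i a) (path j b)))

    -- An even grid function vanishes on white squares, and a black square strictly above the
    -- diagonal is at least two columns away from it, within the range of `difference`.
    difference≡0⇒symmetric :
      (∀ {i j} → i < M → j < M → i ≤ j → 2 ∣ i ℕ.+ j → difference f i j ≡ 0ℚ) →
      ∀ {a b} → a < N → b < N → f a b ≡ f b a
    difference≡0⇒symmetric d≡0 {a} {b} a<N b<N = bySide (ℕ.<-cmp a b)
      where
      above : ∀ {a b} → a < b → b < N → f a b ≡ f b a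
      above {a} {b} a<b b<N with even-or-odd (a ℕ.+ b)
      ... | inj₂ odd = minus≡0⇒≡ (difference-odd odd)
      above {a} {suc zero} (s≤s z≤n) b<N | inj₁ even = contradiction even
        (even⇒suc-odd (divides 0 refl))
      above {a} {suc (suc c)} a<b b<N | inj₁ even with a ℕ.≤? c
      ... | yes a≤c = minus≡0⇒≡ (d≡0 (ℕ.<-≤-trans (s≤s a≤c) c<M) c<M a≤c even′)
        where
        c<M : c < M
        c<M = s<s⁻¹ (s<s⁻¹ (subst (2 ℕ.+ c <_) N≡2+M b<N))
        even′ : 2 ∣ a ℕ.+ c
        even′ with even-or-odd (a ℕ.+ c)
        ... | inj₁ e = e
        ... | inj₂ o = contradiction (2∣2+ o)
          (even⇒suc-odd (subst (2 ∣_) (trans (ℕ.+-suc a (suc c)) (cong suc (ℕ.+-suc a c))) even))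
      ... | no a≰c with ℕ.≤-antisym (ℕ.≰⇒> a≰c) (s≤s⁻¹ a<b)
      ...   | refl = contradiction (subst (2 ∣_) (ℕ.+-suc (suc c) (suc c)) even)
                                   (even⇒suc-odd (even[m+m] (suc c)))
      bySide : _ → f a b ≡ f b a
      bySide (tri< a<b _ _)  = above a<b b<N
      bySide (tri≈ _ refl _) = refl
      bySide (tri> _ _ b<a)  = sym (above b<a a<N)

  symmetric⇒squareCommutator-antisymmetric : ∀ {f} → f ≈ flip f →
    ∀ {i j} → i < N → j < N → squareCommutator f j i ≡ - squareCommutator f i j
  symmetric⇒squareCommutator-antisymmetric {f} f≈fᵗ {i} {j} i<N j<N = begin
    left (left f) j i - right (right f) j i
      ≡⟨ cong₂ _-_
           (left-cong {left f} {left (flip f)} (left-cong {f} {flip f} f≈fᵗ) j<N i<N)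
           (right-cong {right f} {right (flip f)} (right-cong {f} {flip f} f≈fᵗ) j<N i<N) ⟩
    right (right f) i j - left (left f) i j
      ≡⟨ solve 2 (λ x y → x :- y := :- (y :- x)) refl (right (right f) i j) (left (left f) i j) ⟩
    - (left (left f) i j - right (right f) i j) ∎
    where open ≡-Reasoning

  differences-determine : ∀ {f} → HasParity 1ℚ f →
    (∀ {i j} → i < M → j < M → i ≤ j → 2 ∣ i ℕ.+ j → difference f i j ≡ 0ℚ) →
    (∀ {i j} → i < M → j < M → i ≤ j → 2 ∣ i ℕ.+ j → difference (squareCommutator f) i j ≡ 0ℚ) →
    ∀ {i j} → i < N → j < N → squareCommutator f i j ≡ 0ℚ
  differences-determine {f} pf d≡0 dsq≡0 {i} {j} i<N j<N = p≡-p⇒p≡0 (trans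
    (difference≡0⇒symmetric {squareCommutator f} (parity-squareCommutator {f} pf) dsq≡0 i<N j<N)
    (symmetric⇒squareCommutator-antisymmetric {f} (difference≡0⇒symmetric {f} pf d≡0) i<N j<N))

-- From matrices to graphs

∑ˡ-zero : ∀ {A : Set} (xs : List A) {f : A → ℚ} → (∀ x → f x ≡ 0ℚ) → ∑ˡ xs f ≡ 0ℚ
∑ˡ-zero xs {f} f≡0 = sum-zero {length xs} (λ i → f (lookup xs i)) (λ i → f≡0 (lookup xs i))

sum²≡∑² : ∀ m n (f : ℕ → ℕ → ℚ) →
  sum {m} (λ i → sum {n} (λ j → f (toℕ i) (toℕ j))) ≡ ∑ m (λ i → ∑ n (f i))
sum²≡∑² m n f = trans (sum-cong-≗ {m} (λ i → sym (∑≡sum n (f (toℕ i)))))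
                      (sym (∑≡sum m (λ i → ∑ n (f i))))

dist≤1,≢1⇒≡ : ∀ {i j} → ∣ i - j ∣ ≤ 1 → ∣ i - j ∣ ≢ 1 → i ≡ j
dist≤1,≢1⇒≡ {i} {j} d≤1 d≢1 = ℕ.∣m-n∣≡0⇒m≡n (ℕ.n<1⇒n≡0 (ℕ.≤∧≢⇒< d≤1 d≢1))

same-parity⇒distance≢1 : ∀ c {i j} → 2 ∣ c ℕ.+ i → 2 ∣ c ℕ.+ j → ∣ i - j ∣ ≢ 1
same-parity⇒distance≢1 c {i} {j} ei ej d≡1 with distance≡1⇒neighbours i j d≡1
... | inj₁ refl = even⇒suc-odd ei (subst (2 ∣_) (ℕ.+-suc c i) ej)
... | inj₂ refl = even⇒suc-odd ej (subst (2 ∣_) (ℕ.+-suc c j) ei)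

-- Sharing a corner permits every king's move. Between distinct black squares the horizontal and
-- vertical moves are excluded by colour, which leaves one step along the path in each coordinate.
entry-OD : ∀ n {u v : Vertex (OD n)} → Black u → Black v →
  entry (OD n) u v ≡ path (toℕ (proj₁ u)) (toℕ (proj₁ v)) * path (toℕ (proj₂ u)) (toℕ (proj₂ v))
entry-OD n {u@(i , j)} {v@(a , b)} bu bv = if-dec (adj? (OD n) u v) adjacent non-adjacent
  where
  di dj : ℕ
  di = ∣ toℕ i - toℕ a ∣
  dj = ∣ toℕ j - toℕ b ∣
  j-even : 2 ∣ toℕ j ℕ.+ toℕ i
  j-even = subst (2 ∣_) (ℕ.+-comm (toℕ i) (toℕ j)) bu
  adjacent : u ≢ v × ShareCorner u v → 1ℚ ≡ path (toℕ i) (toℕ a) * path (toℕ j) (toℕ b)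
  adjacent (u≢v , di≤1 , dj≤1) = cases (di ℕ.≟ 1) (dj ℕ.≟ 1)
    where
    cases : Dec (di ≡ 1) → Dec (dj ≡ 1) → 1ℚ ≡ path (toℕ i) (toℕ a) * path (toℕ j) (toℕ b)
    cases (yes di≡1) (yes dj≡1) = sym (cong₂ _*_
      (distance≡1⇒path≡1 {toℕ i} {toℕ a} di≡1) (distance≡1⇒path≡1 {toℕ j} {toℕ b} dj≡1))
    cases (yes di≡1) (no dj≢1) with toℕ-injective {i = j} {j = b} (dist≤1,≢1⇒≡ dj≤1 dj≢1)
    ... | refl = contradiction di≡1 (same-parity⇒distance≢1 (toℕ j) j-even
                   (subst (2 ∣_) (ℕ.+-comm (toℕ a) (toℕ j)) bv))
    cases (no di≢1) dj? with toℕ-injective {i = i} {j = a} (dist≤1,≢1⇒≡ di≤1 di≢1) | dj?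
    ... | refl | yes dj≡1 = contradiction dj≡1 (same-parity⇒distance≢1 (toℕ i) bu bv)
    ... | refl | no dj≢1  = contradiction
      (cong (i ,_) (toℕ-injective {i = j} {j = b} (dist≤1,≢1⇒≡ dj≤1 dj≢1))) u≢v
  non-adjacent : ¬ (u ≢ v × ShareCorner u v) → 0ℚ ≡ path (toℕ i) (toℕ a) * path (toℕ j) (toℕ b)
  non-adjacent ¬adj = cases (di ℕ.≟ 1) (dj ℕ.≟ 1)
    where
    cases : Dec (di ≡ 1) → Dec (dj ≡ 1) → 0ℚ ≡ path (toℕ i) (toℕ a) * path (toℕ j) (toℕ b)
    cases (yes di≡1) (yes dj≡1) = contradiction
      ( (λ u≡v → contradiction
          (trans (sym di≡1) (ℕ.m≡n⇒∣m-n∣≡0 (cong (toℕ ∘ proj₁) u≡v))) λ ())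
      , ℕ.≤-reflexive di≡1 , ℕ.≤-reflexive dj≡1) ¬adj
    cases (no di≢1) _ = sym (trans
      (cong (_* path (toℕ j) (toℕ b)) (distance≢1⇒path≡0 {toℕ i} {toℕ a} di≢1))
      (ℚ.*-zeroˡ (path (toℕ j) (toℕ b))))
    cases (yes _) (no dj≢1) = sym (trans
      (cong (path (toℕ i) (toℕ a) *_) (distance≢1⇒path≡0 {toℕ j} {toℕ b} dj≢1))
      (ℚ.*-zeroʳ (path (toℕ i) (toℕ a))))


path-suc : ∀ i → path i (suc i) ≡ 1ℚ
path-suc zero    = refl
path-suc (suc i) = path-suc i

path-neighbours : ∀ {i j} → suc i ≡ j ⊎ suc j ≡ i → path i j ≡ 1ℚ
path-neighbours {i} (inj₁ refl)     = path-suc i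
path-neighbours {j = j} (inj₂ refl) = trans (path-sym (suc j) j) (path-suc j)

loopedPath-entry : ∀ n c (u v : Fin n) → entry (withLoops (P n) Fin._≟_ c) u v ≡
                   path (toℕ u) (toℕ v) + c * δ (toℕ u) (toℕ v)
loopedPath-entry n c u v = go (u Fin.≟ v)
  where
  go : (u≟v : Dec (u ≡ v)) →
       (if does (u≟v ⊎-dec adj? (P n) u v) then (if does u≟v then c else 1ℚ) else 0ℚ) ≡
       path (toℕ u) (toℕ v) + c * δ (toℕ u) (toℕ v)
  go (yes refl) = sym (trans
    (cong₂ (λ p d → p + c * d)
      (distance≢1⇒path≡0 {toℕ u} {toℕ u} (λ d≡1 → contradiction
        (trans (sym (ℕ.m≡n⇒∣m-n∣≡0 {toℕ u} refl)) d≡1) λ ()))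
      (δ-refl (toℕ u)))
    (solve 1 (λ c → con 0ℚ :+ c :* con 1ℚ := c) refl c))
  go (no u≢v) = trans
    (if-dec (adj? (P n) u v)
      (λ adj → sym (path-neighbours adj)) (λ ¬adj → sym (path-non-neighbours ¬adj)))
    (sym (trans (cong (λ d → path (toℕ u) (toℕ v) + c * d) (δ-≢ (u≢v ∘ toℕ-injective)))
      (solve 2 (λ p c → p :+ c :* con 0ℚ := p) refl (path (toℕ u) (toℕ v)) c)))

if-cong : ∀ {P A : Set} (P? : Dec P) {x y z : A} → (P → x ≡ y) →
          (if does P? then x else z) ≡ (if does P? then y else z)
if-cong (yes p) x≡y = x≡y p
if-cong (no _)  _   = refl

lookup-injective : ∀ {A : Set} {xs : List A} → Unique xs → ∀ {i j} →
                   lookup xs i ≡ lookup xs j → i ≡ j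
lookup-injective (x∉xs ∷ _) {zero}  {zero}  _  = refl
lookup-injective (x∉xs ∷ _) {zero}  {suc j} eq = contradiction eq (All.lookup x∉xs (∈-lookup j))
lookup-injective (x∉xs ∷ _) {suc i} {zero}  eq = contradiction (sym eq)
  (All.lookup x∉xs (∈-lookup i))
lookup-injective (_ ∷ uniq) {suc i} {suc j} eq = cong suc (lookup-injective uniq eq)

∈-OD⁻ : ∀ {n} {u : Vertex (OD n)} → u ∈ vertices (OD n) → Black u
∈-OD⁻ {n} u∈ = proj₂ (∈-filter⁻ black? {xs = cartesianProduct (allFin (suc (2 ℕ.* n)))
  (allFin (suc (2 ℕ.* n)))} u∈)

∈-HOD⁻ : ∀ {n} {u : Vertex (HOD n)} → u ∈ vertices (HOD n) → Black u × OnOrAboveDiagonal u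
∈-HOD⁻ {n} u∈ with ∈-filter⁻ onOrAboveDiagonal? {xs = vertices (OD n)} u∈
... | u∈OD , above = ∈-OD⁻ {n} u∈OD , above

∈-HOD⁺ : ∀ {n} {u : Vertex (HOD n)} → Black u → OnOrAboveDiagonal u → u ∈ vertices (HOD n)
∈-HOD⁺ {u = i , j} black above = ∈-filter⁺ onOrAboveDiagonal?
  (∈-filter⁺ black? (∈-cartesianProduct⁺ (∈-allFin i) (∈-allFin j)) black) above

∑ˡ-OD : ∀ n (g : Vertex (OD n) → ℚ) (h : ℕ → ℕ → ℚ) →
  (∀ i j → Black (i , j) → g (i , j) ≡ h (toℕ i) (toℕ j)) →
  ∑ˡ (vertices (OD n)) g ≡
    ∑ (suc (2 ℕ.* n)) (λ i → ∑ (suc (2 ℕ.* n))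
      (λ j → if does (2 ∣? (i ℕ.+ j)) then h i j else 0ℚ))
∑ˡ-OD n g h g≡h = begin
  ∑ˡ (vertices (OD n)) g
    ≡⟨ ∑ˡ-filter black? (cartesianProduct (allFin k) (allFin k)) g ⟩
  ∑ˡ (cartesianProduct (allFin k) (allFin k)) (λ u → if does (black? u) then g u else 0ℚ)
    ≡⟨ ∑ˡ-allFin² k k (λ u → if does (black? u) then g u else 0ℚ) ⟩
  sum {k} (λ i → sum {k} (λ j → if does (black? (i , j)) then g (i , j) else 0ℚ))
    ≡⟨ sum-cong-≗ {k} (λ i → sum-cong-≗ {k} (λ j → if-cong (black? (i , j)) {z = 0ℚ} (g≡h i j))) ⟩
  sum {k} (λ i → sum {k} (λ j → if does (2 ∣? (toℕ i ℕ.+ toℕ j)) then h (toℕ i) (toℕ j) else 0ℚ))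
    ≡⟨ sum²≡∑² k k (λ i j → if does (2 ∣? (i ℕ.+ j)) then h i j else 0ℚ) ⟩
  ∑ k (λ i → ∑ k (λ j → if does (2 ∣? (i ℕ.+ j)) then h i j else 0ℚ)) ∎
  where
  open ≡-Reasoning
  k : ℕ
  k = suc (2 ℕ.* n)

-- Linear functionals and maps compatible with adjacency

module _ (N : ℕ) where
  open Operators N

  -- The field `respects` stands in for function extensionality and discards the values off the
  -- board. Combinations of any length are what the products `Θ · A` and `Θ ·ᵥ x` produce.
  record Linear (Φ : Grid → ℚ) : Set where
    field
      respects    : ∀ {f g} → f ≈ g → Φ f ≡ Φ g
      combination : ∀ {k} (c : Fin k → ℚ) (f : Fin k → Grid) →
                    Φ (λ i j → sum (λ l → c l * f l i j)) ≡ sum (λ l → c l * Φ (f l))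

  open Linear

  LinearOperator : (Grid → Grid) → Set
  LinearOperator Ψ = ∀ {i j} → i < N → j < N → Linear (λ f → Ψ f i j)

  linear-∘ : ∀ {Φ Ψ} → Linear Φ → LinearOperator Ψ → Linear (λ f → Φ (Ψ f))
  linear-∘ {Φ} {Ψ} lΦ lΨ = record
    { respects    = λ {f} {g} f≈g → respects lΦ {Ψ f} {Ψ g}
      (λ i<N j<N → respects (lΨ i<N j<N) {f} {g} f≈g)
    ; combination = λ {k} c f → trans
        (respects lΦ {Ψ (λ i j → sum {k} (λ l → c l * f l i j))}
          {λ i j → sum {k} (λ l → c l * Ψ (f l) i j)}
          (λ i<N j<N → combination (lΨ i<N j<N) {k} c f))
        (combination lΦ {k} c (λ l → Ψ (f l)))
    }

  linear-at : ∀ {i j} → i < N → j < N → Linear (λ f → f i j)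
  linear-at i<N j<N = record { respects = λ f≈g → f≈g i<N j<N ; combination = λ _ _ → refl }

  linear-+ : ∀ {Φ Ψ} → Linear Φ → Linear Ψ → Linear (λ f → Φ f + Ψ f)
  linear-+ {Φ} {Ψ} lΦ lΨ = record
    { respects    = λ {f} {g} f≈g → cong₂ _+_ (respects lΦ {f} {g} f≈g) (respects lΨ {f} {g} f≈g)
    ; combination = λ {k} c f → trans (cong₂ _+_ (combination lΦ {k} c f)
      (combination lΨ {k} c f))
        (trans (sym (∑-distrib-+ {k} (λ l → c l * Φ (f l)) (λ l → c l * Ψ (f l))))
               (sum-cong-≗ {k} (λ l → sym (ℚ.*-distribˡ-+ (c l) (Φ (f l)) (Ψ (f l))))))
    }

  linear-* : ∀ {Φ} c → Linear Φ → Linear (λ f → c * Φ f)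
  linear-* {Φ} a lΦ = record
    { respects    = λ {f} {g} f≈g → cong (a *_) (respects lΦ {f} {g} f≈g)
    ; combination = λ {k} c f → trans (cong (a *_) (combination lΦ {k} c f))
        (trans (*-distribˡ-sum {k} a (λ l → c l * Φ (f l)))
               (sum-cong-≗ {k} (λ l → solve 3 (λ a c x → a :* (c :* x) := c :* (a :* x)) refl a
                 (c l) (Φ (f l)))))
    }

  linear-resp : ∀ {Φ Ψ} → (∀ f → Φ f ≡ Ψ f) → Linear Φ → Linear Ψ
  linear-resp {Φ} {Ψ} Φ≡Ψ lΦ = record
    { respects    = λ {f} {g} f≈g → trans (sym (Φ≡Ψ f)) (trans (respects lΦ {f} {g} f≈g) (Φ≡Ψ g))
    ; combination = λ {k} c f → trans (sym (Φ≡Ψ (λ i j → sum {k} (λ l → c l * f l i j))))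
        (trans (combination lΦ {k} c f) (sum-cong-≗ {k} (λ l → cong (c l *_) (Φ≡Ψ (f l)))))
    }

  linear-minus : ∀ {Φ Ψ} → Linear Φ → Linear Ψ → Linear (λ f → Φ f - Ψ f)
  linear-minus {Φ} {Ψ} lΦ lΨ = linear-resp {λ f → Φ f + - 1ℚ * Ψ f}
    (λ f → solve 2 (λ x y → x :+ con (- 1ℚ) :* y := x :- y) refl (Φ f) (Ψ f))
    (linear-+ {Φ} {λ f → - 1ℚ * Ψ f} lΦ (linear-* {Ψ} (- 1ℚ) lΨ))

  linear-0 : Linear (λ _ → 0ℚ)
  linear-0 = record
    { respects    = λ _ → refl
    ; combination = λ {k} c f → sym (sum-zero {k} (λ l → c l * 0ℚ) (λ l → ℚ.*-zeroʳ (c l)))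
    }

  linear-∑ : ∀ n {Φ : ℕ → Grid → ℚ} → (∀ {l} → l < n → Linear (Φ l)) → Linear
    (λ f → ∑ n (λ l → Φ l f))
  linear-∑ zero    lΦ = linear-0
  linear-∑ (suc n) {Φ} lΦ = linear-+ {Φ 0} {λ f → ∑ n (λ l → Φ (suc l) f)} (lΦ z<s)
    (linear-∑ n {λ l → Φ (suc l)} (λ l<n → lΦ (s<s l<n)))

  linear-left : LinearOperator left
  linear-left {i} {j} _ j<N = linear-∑ N {λ a f → path i a * f a j}
    (λ {a} a<N → linear-* {λ f → f a j} (path i a) (linear-at a<N j<N))

  linear-right : LinearOperator right
  linear-right {i} {j} i<N _ = linear-∑ N {λ b f → path j b * f i b}
    (λ {b} b<N → linear-* {λ f → f i b} (path j b) (linear-at i<N b<N))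

  linear-⟨⟩ : ∀ w → Linear (λ f → ⟨ w , f ⟩)
  linear-⟨⟩ w = linear-∑ N {λ i f → ∑ N (λ j → w i j * f i j)} (λ {i} i<N →
    linear-∑ N {λ j f → w i j * f i j} (λ {j} j<N → linear-* {λ f → f i j} (w i j)
      (linear-at i<N j<N)))

  linear-anticommutator : LinearOperator anticommutator
  linear-anticommutator {i} {j} i<N j<N =
    linear-+ {λ f → left f i j} {λ f → right f i j} (linear-left i<N j<N) (linear-right i<N j<N)

  linear-twisted-commutator : LinearOperator (λ f → twist (commutator f))
  linear-twisted-commutator {i} {j} i<N j<N = linear-* {λ f → commutator f i j} (ε j)
    (linear-minus {λ f → left f i j} {λ f → right f i j} (linear-left i<N j<N)
      (linear-right i<N j<N))

  linear-squareCommutator : LinearOperator squareCommutator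
  linear-squareCommutator {i} {j} i<N j<N =
    linear-minus {λ f → left (left f) i j} {λ f → right (right f) i j}
      (linear-∘ {λ f → left f i j} {left} (linear-left i<N j<N) linear-left)
      (linear-∘ {λ f → right f i j} {right} (linear-right i<N j<N) linear-right)

  -- For `HOD`, membership of `u` in the vertex list supplies that the square is black and on or
  -- above the diagonal.
  Intertwines : (G : WeightedGraph) → (Grid → Vertex G → ℚ) → Set
  Intertwines G F = ∀ {f} → HasParity 1ℚ f → ∀ u → u ∈ vertices G →
    F (diamond f) u ≡ ∑ˡ (vertices G) (λ v → entry G u v * F f v)

  intertwines-∪̇ : ∀ {G H F F′} → Intertwines G F → Intertwines H F′ →
                  Intertwines (G ∪̇ H) (λ f → [ F f , F′ f ]′)
  intertwines-∪̇ {G} {H} {F} {F′} iG iH {f} pf u u∈ = byPart u (∈-++⁻ (map inj₁ (vertices G)) u∈)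
    where
    open ≡-Reasoning
    g : Vertex (G ∪̇ H) → Vertex (G ∪̇ H) → ℚ
    g u v = entry (G ∪̇ H) u v * [ F f , F′ f ]′ v
    split : ∀ u → ∑ˡ (vertices (G ∪̇ H)) (g u) ≡
                  ∑ˡ (vertices G) (g u ∘ inj₁) + ∑ˡ (vertices H) (g u ∘ inj₂)
    split u = trans (∑ˡ-++ (map inj₁ (vertices G)) (map inj₂ (vertices H)) (g u))
      (cong₂ _+_ (∑ˡ-map inj₁ (vertices G) (g u)) (∑ˡ-map inj₂ (vertices H) (g u)))
    byPart : ∀ u → u ∈ map inj₁ (vertices G) ⊎ u ∈ map inj₂ (vertices H) →
      [ F (diamond f) , F′ (diamond f) ]′ u ≡ ∑ˡ (vertices (G ∪̇ H)) (g u)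
    byPart u (inj₁ u∈G) with ∈-map⁻ inj₁ u∈G
    ... | x , x∈G , refl = begin
      F (diamond f) x                                 ≡⟨ iG {f} pf x x∈G ⟩
      ∑ˡ (vertices G) (g (inj₁ x) ∘ inj₁)            
        ≡⟨ ℚ.+-identityʳ (∑ˡ (vertices G) (g (inj₁ x) ∘ inj₁)) ⟨
      ∑ˡ (vertices G) (g (inj₁ x) ∘ inj₁) + 0ℚ
        ≡⟨ cong (∑ˡ (vertices G) (g (inj₁ x) ∘ inj₁) +_)
             (∑ˡ-zero (vertices H) {g (inj₁ x) ∘ inj₂} (λ y → ℚ.*-zeroˡ (F′ f y))) ⟨
      ∑ˡ (vertices G) (g (inj₁ x) ∘ inj₁) + ∑ˡ (vertices H) (g (inj₁ x) ∘ inj₂)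
        ≡⟨ split (inj₁ x) ⟨
      ∑ˡ (vertices (G ∪̇ H)) (g (inj₁ x)) ∎
    byPart u (inj₂ u∈H) with ∈-map⁻ inj₂ u∈H
    ... | y , y∈H , refl = begin
      F′ (diamond f) y                                ≡⟨ iH {f} pf y y∈H ⟩
      ∑ˡ (vertices H) (g (inj₂ y) ∘ inj₂)            
        ≡⟨ ℚ.+-identityˡ (∑ˡ (vertices H) (g (inj₂ y) ∘ inj₂)) ⟨
      0ℚ + ∑ˡ (vertices H) (g (inj₂ y) ∘ inj₂)
        ≡⟨ cong (_+ ∑ˡ (vertices H) (g (inj₂ y) ∘ inj₂))
             (∑ˡ-zero (vertices G) {g (inj₂ y) ∘ inj₁} (λ x → ℚ.*-zeroˡ (F f x))) ⟨
      ∑ˡ (vertices G) (g (inj₂ y) ∘ inj₁) + ∑ˡ (vertices H) (g (inj₂ y) ∘ inj₂)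
        ≡⟨ split (inj₂ y) ⟨
      ∑ˡ (vertices (G ∪̇ H)) (g (inj₂ y)) ∎

-- The intertwining matrix

module Modes (m : ℕ) where
  open Difference m
  open Linear

  n : ℕ
  n = suc m

  Parts : WeightedGraph
  Parts = HOD m ∪̇ HOD m ∪̇ P 1 ∪̇ Q n ∪̇ Q′ n

  hodMode : Grid → Vertex (HOD m) → ℚ
  hodMode f (i , j) = difference f (toℕ i) (toℕ j)

  modes : Grid → Vertex Parts → ℚ
  modes f = [ hodMode f , [ hodMode (squareCommutator f) , [ (λ _ → ⟨ zeroMode , f ⟩) ,
              [ loopMode f ∘ toℕ , loopMode′ f ∘ toℕ ]′ ]′ ]′ ]′

  linear-difference : ∀ {i j} → i < M → j < M → Linear N (λ f → difference f i j)
  linear-difference {i} {j} i<M j<M = linear-minus N {λ f → f i (2 ℕ.+ j)} {λ f → f (2 ℕ.+ j) i}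
    (linear-at N (N> i<M) (N>2+ j<M)) (linear-at N (N>2+ j<M) (N> i<M))

  linear-modes : ∀ u → Linear N (λ f → modes f u)
  linear-modes (inj₁ (i , j)) = linear-difference (toℕ<n i) (toℕ<n j)
  linear-modes (inj₂ (inj₁ (i , j))) =
    linear-∘ N {λ f → difference f (toℕ i) (toℕ j)} {squareCommutator}
      (linear-difference (toℕ<n i) (toℕ<n j)) (linear-squareCommutator N)
  linear-modes (inj₂ (inj₂ (inj₁ _))) = linear-⟨⟩ N zeroMode
  linear-modes (inj₂ (inj₂ (inj₂ (inj₁ k)))) =
    linear-∘ N {λ f → ⟨ W (suc (toℕ k) ℕ.* 2) , f ⟩} {anticommutator}
      (linear-⟨⟩ N (W (suc (toℕ k) ℕ.* 2))) (linear-anticommutator N)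
  linear-modes (inj₂ (inj₂ (inj₂ (inj₂ k)))) =
    linear-* N {λ f → ⟨ W (suc (toℕ k) ℕ.* 2) , twist (commutator f) ⟩} (ε (toℕ k))
      (linear-∘ N {λ f → ⟨ W (suc (toℕ k) ℕ.* 2) , f ⟩} {λ f → twist (commutator f)}
        (linear-⟨⟩ N (W (suc (toℕ k) ℕ.* 2))) (linear-twisted-commutator N))

  hodMode-diamond : ∀ {f} → HasParity 1ℚ f → ∀ u → u ∈ vertices (HOD m) →
    hodMode (diamond f) u ≡ ∑ˡ (vertices (HOD m)) (λ v → entry (HOD m) u v * hodMode f v)
  hodMode-diamond {f} pf u@(i , j) u∈ = begin
    difference (diamond f) (toℕ i) (toℕ j)
      ≡⟨ difference-diamond {f} pf u-above ⟩
    ∑ M (λ a → ∑ M (λ b → if does (2 ∣? (a ℕ.+ b)) then term a b else 0ℚ))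
      ≡⟨ ∑ˡ-OD m (λ v → if does (onOrAboveDiagonal? v) then entry (HOD m) u v * hodMode f v else
           0ℚ) term
           (λ a b black → if-cong (onOrAboveDiagonal? (a , b)) {z = 0ℚ} (λ _ →
             cong (_* hodMode f (a , b)) (entry-OD m {u} {a , b} u-black black))) ⟨
    ∑ˡ (vertices (OD m)) (λ v → if does (onOrAboveDiagonal? v) then entry (HOD m) u v * hodMode f
      v else 0ℚ)
      ≡⟨ ∑ˡ-filter onOrAboveDiagonal? (vertices (OD m)) (λ v → entry (HOD m) u v * hodMode f v) ⟨
    ∑ˡ (vertices (HOD m)) (λ v → entry (HOD m) u v * hodMode f v) ∎
    where
    open ≡-Reasoning
    u-black : Black u
    u-black = proj₁ (∈-HOD⁻ {m} u∈)
    u-above : OnOrAboveDiagonal u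
    u-above = proj₂ (∈-HOD⁻ {m} u∈)
    term : ℕ → ℕ → ℚ
    term a b = if does (a ℕ.≤? b)
               then path (toℕ i) a * path (toℕ j) b * difference f a b else 0ℚ

  hodMode-squareCommutator-diamond : Intertwines N (HOD m) (λ f → hodMode (squareCommutator f))
  hodMode-squareCommutator-diamond {f} pf u@(i , j) u∈ = trans
    (cong₂ _-_ (diamond-squareCommutator f (toℕ i) (2 ℕ.+ toℕ j))
               (diamond-squareCommutator f (2 ℕ.+ toℕ j) (toℕ i)))
    (hodMode-diamond {squareCommutator f} (parity-squareCommutator {f} pf) u u∈)

  zeroMode-diamond : Intertwines N (P 1) (λ f _ → ⟨ zeroMode , f ⟩)
  zeroMode-diamond {f} _ zero _ = trans (⟨zeroMode,diamond⟩ f)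
    (solve 1 (λ x → con 0ℚ := con 0ℚ :* x :+ con 0ℚ) refl ⟨ zeroMode , f ⟩)

  ∑ˡ-loopedPath : ∀ c (x : ℕ → ℚ) (u : Fin n) →
    ∑ n (λ k → (path (toℕ u) k + c * δ (toℕ u) k) * x k) ≡
    ∑ˡ (allFin n) (λ v → entry (withLoops (P n) Fin._≟_ c) u v * x (toℕ v))
  ∑ˡ-loopedPath c x u = begin
    ∑ n (λ k → (path (toℕ u) k + c * δ (toℕ u) k) * x k)
      ≡⟨ ∑≡sum n (λ k → (path (toℕ u) k + c * δ (toℕ u) k) * x k) ⟩
    sum {n} (λ v → (path (toℕ u) (toℕ v) + c * δ (toℕ u) (toℕ v)) * x (toℕ v))
      ≡⟨ sum-cong-≗ {n} (λ v → cong (_* x (toℕ v)) (sym (loopedPath-entry n c u v))) ⟩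
    sum {n} (λ v → entry (withLoops (P n) Fin._≟_ c) u v * x (toℕ v))
      ≡⟨ ∑ˡ-tabulate {n = n} (λ v → v) (λ v → entry (withLoops (P n) Fin._≟_ c) u v * x (toℕ v)) ⟨
    ∑ˡ (allFin n) (λ v → entry (withLoops (P n) Fin._≟_ c) u v * x (toℕ v)) ∎
    where open ≡-Reasoning

  modes-diamond : Intertwines N Parts modes
  modes-diamond =
    intertwines-∪̇ N {HOD m} {HOD m ∪̇ P 1 ∪̇ Q n ∪̇ Q′ n} {hodMode} hodMode-diamond
    (intertwines-∪̇ N {HOD m} {P 1 ∪̇ Q n ∪̇ Q′ n} {λ f → hodMode (squareCommutator f)}
      hodMode-squareCommutator-diamond
    (intertwines-∪̇ N {P 1} {Q n ∪̇ Q′ n} {λ f _ → ⟨ zeroMode , f ⟩} zeroMode-diamond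
    (intertwines-∪̇ N {Q n} {Q′ n} {λ f → loopMode f ∘ toℕ} {λ f → loopMode′ f ∘ toℕ}
      (λ {f} _ u _ → trans (loopMode-diamond f (toℕ<n u)) (∑ˡ-loopedPath 2ℚ (loopMode f) u))
      (λ {f} _ u _ → trans (loopMode′-diamond f (toℕ<n u))
        (∑ˡ-loopedPath (- 2ℚ) (loopMode′ f) u)))))

  modes-determine : ∀ {f} → HasParity 1ℚ f → (∀ u → u ∈ vertices Parts → modes f u ≡ 0ℚ) →
                    ∀ {i j} → i < N → j < N → f i j ≡ 0ℚ
  modes-determine {f} pf modes≡0 = even-modes-determine {f} pf
    (differences-determine {f} pf (hod≡0 f (λ u u∈ → modes≡0 (inj₁ u) (first u∈)))
      (hod≡0 (squareCommutator f) (λ u u∈ → modes≡0 (inj₂ (inj₁ u)) (rest₁ (first u∈)))))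
    (modes≡0 (inj₂ (inj₂ (inj₁ zero))) (rest₁ (rest₂ (first (∈-allFin zero)))))
    (λ {k} k<n → trans (cong (loopMode f) (sym (toℕ-fromℕ< k<n)))
      (modes≡0 (inj₂ (inj₂ (inj₂ (inj₁ (fromℕ< k<n)))))
        (rest₁ (rest₂ (rest₃ (first (∈-allFin (fromℕ< k<n))))))))
    (λ {k} k<n → trans (cong (loopMode′ f) (sym (toℕ-fromℕ< k<n)))
      (modes≡0 (inj₂ (inj₂ (inj₂ (inj₂ (fromℕ< k<n)))))
        (rest₁ (rest₂ (rest₃ (second (vertices (Q n)) (∈-allFin (fromℕ< k<n))))))))
    where
    first : ∀ {A B : Set} {xs : List A} {ys : List B} {x} → x ∈ xs → inj₁ x ∈ map inj₁ xs ++ map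
      inj₂ ys
    first x∈ = ∈-++⁺ˡ (∈-map⁺ inj₁ x∈)
    second : ∀ {A B : Set} (xs : List A) {ys : List B} {y} → y ∈ ys → inj₂ y ∈ map inj₁ xs ++ map
      inj₂ ys
    second xs y∈ = ∈-++⁺ʳ (map inj₁ xs) (∈-map⁺ inj₂ y∈)
    rest₁ : ∀ {u} → u ∈ vertices (HOD m ∪̇ P 1 ∪̇ Q n ∪̇ Q′ n) → inj₂ u ∈ vertices Parts
    rest₁ = second (vertices (HOD m))
    rest₂ : ∀ {u} → u ∈ vertices (P 1 ∪̇ Q n ∪̇ Q′ n) → inj₂ u ∈ vertices
      (HOD m ∪̇ P 1 ∪̇ Q n ∪̇ Q′ n)
    rest₂ = second (vertices (HOD m))
    rest₃ : ∀ {u} → u ∈ vertices (Q n ∪̇ Q′ n) → inj₂ u ∈ vertices (P 1 ∪̇ Q n ∪̇ Q′ n)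
    rest₃ = second (vertices (P 1))
    hod≡0 : ∀ g → (∀ u → u ∈ vertices (HOD m) → hodMode g u ≡ 0ℚ) →
            ∀ {i j} → i < M → j < M → i ≤ j → 2 ∣ i ℕ.+ j → difference g i j ≡ 0ℚ
    hod≡0 g hod {i} {j} i<M j<M i≤j even = trans
      (sym (cong₂ (difference g) (toℕ-fromℕ< i<M) (toℕ-fromℕ< j<M)))
      (hod (fromℕ< i<M , fromℕ< j<M) (∈-HOD⁺ {m}
        (subst (2 ∣_) (sym (cong₂ ℕ._+_ (toℕ-fromℕ< i<M) (toℕ-fromℕ< j<M))) even)
        (subst (λ a → a ≤ toℕ (fromℕ< j<M)) (sym (toℕ-fromℕ< i<M))
          (subst (i ≤_) (sym (toℕ-fromℕ< j<M)) i≤j))))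

  indicator : Vertex (OD n) → Grid
  indicator (p , q) a b = δ (toℕ p) a * δ (toℕ q) b

  indicator-≢ : ∀ {p q a b} → ¬ (toℕ p ≡ a × toℕ q ≡ b) → indicator (p , q) a b ≡ 0ℚ
  indicator-≢ {p} {q} {a} {b} pq≢ab with toℕ p ℕ.≟ a
  ... | no p≢a  = trans (cong (_* δ (toℕ q) b) (δ-≢ p≢a)) (ℚ.*-zeroˡ (δ (toℕ q) b))
  ... | yes p≡a = trans (cong (δ (toℕ p) a *_) (δ-≢ (λ q≡b → pq≢ab (p≡a , q≡b))))
    (ℚ.*-zeroʳ (δ (toℕ p) a))

  indicator-even : ∀ {v} → Black v → HasParity 1ℚ (indicator v)
  indicator-even {p , q} black = vanishing⇒even {indicator (p , q)}
    (λ ¬even → indicator-≢ {p} {q} (λ { (refl , refl) → ¬even black }))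

  diamond-indicator : ∀ u i j → diamond (indicator u) i j ≡
                      path i (toℕ (proj₁ u)) * path j (toℕ (proj₂ u))
  diamond-indicator (p , q) i j = begin
    A* (λ a → A* (λ b → δ (toℕ p) a * δ (toℕ q) b) j) i
      ≡⟨ A*-cong (λ {a} _ → trans (A*-*ˡ (δ (toℕ p) a) (δ (toℕ q)) j)
           (trans (cong (δ (toℕ p) a *_) (trans (A*-δ j (toℕ<n q)) (path-sym (toℕ q) j)))
             (ℚ.*-comm (δ (toℕ p) a) (path j (toℕ q))))) i ⟩
    A* (λ a → path j (toℕ q) * δ (toℕ p) a) i
      ≡⟨ A*-*ˡ (path j (toℕ q)) (δ (toℕ p)) i ⟩
    path j (toℕ q) * A* (δ (toℕ p)) i
      ≡⟨ cong (path j (toℕ q) *_) (trans (A*-δ i (toℕ<n p)) (path-sym (toℕ p) i)) ⟩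
    path j (toℕ q) * path i (toℕ p)  ≡⟨ ℚ.*-comm (path j (toℕ q)) (path i (toℕ p)) ⟩
    path i (toℕ p) * path j (toℕ q)  ∎
    where open ≡-Reasoning

  -- On even grid functions, diamond is the adjacency matrix of OD n.
  ∑ˡ-entry-indicator : ∀ {u} → Black u → ∀ {a b} → a < N → b < N →
    ∑ˡ (vertices (OD n)) (λ v → entry (OD n) v u * indicator v a b) ≡ diamond (indicator u) a b
  ∑ˡ-entry-indicator {u} black {a} {b} a<N b<N = begin
    ∑ˡ (vertices (OD n)) (λ v → entry (OD n) v u * indicator v a b)
      ≡⟨ ∑ˡ-OD n (λ v → entry (OD n) v u * indicator v a b)
           (λ i j → path i u₁ * path j u₂ * (δ i a * δ j b))
           (λ i j ij-black → cong (_* indicator (i , j) a b)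
             (entry-OD n {i , j} {u} ij-black black)) ⟩
    ∑ N (λ i → ∑ N (λ j →
      if does (2 ∣? (i ℕ.+ j)) then path i u₁ * path j u₂ * (δ i a * δ j b) else 0ℚ))
      ≡⟨ ∑-cong² N N (λ {i} {j} _ _ → term i j) ⟩
    ∑ N (λ i → ∑ N (λ j → δ a i * (δ b j * Y i j)))
      ≡⟨ ∑-cong N (λ {i} _ → trans (∑-*ˡ N (δ a i) (λ j → δ b j * Y i j))
           (cong (δ a i *_) (∑-δ (Y i) b<N))) ⟩
    ∑ N (λ i → δ a i * Y i b)
      ≡⟨ ∑-δ (λ i → Y i b) a<N ⟩
    Y a b
      ≡⟨ if-dec (2 ∣? (a ℕ.+ b)) (λ _ → sym (diamond-indicator u a b)) odd ⟩
    diamond (indicator u) a b ∎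
    where
    open ≡-Reasoning
    u₁ u₂ : ℕ
    u₁ = toℕ (proj₁ u)
    u₂ = toℕ (proj₂ u)
    Y : ℕ → ℕ → ℚ
    Y i j = if does (2 ∣? (i ℕ.+ j)) then path i u₁ * path j u₂ else 0ℚ
    pull-if : ∀ {P : Set} (P? : Dec P) y e d → (if does P? then y * (e * d) else 0ℚ) ≡
      e * (d * (if does P? then y else 0ℚ))
    pull-if (yes _) = solve 3 (λ y e d → y :* (e :* d) := e :* (d :* y)) refl
    pull-if (no _) y = solve 2 (λ e d → con 0ℚ := e :* (d :* con 0ℚ)) refl
    term : ∀ i j →
      (if does (2 ∣? (i ℕ.+ j)) then path i u₁ * path j u₂ * (δ i a * δ j b) else 0ℚ) ≡
      δ a i * (δ b j * Y i j)
    term i j = trans (pull-if (2 ∣? (i ℕ.+ j)) (path i u₁ * path j u₂) (δ i a) (δ j b))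
      (cong₂ (λ x y → x * (y * Y i j)) (δ-sym i a) (δ-sym j b))
    odd : ¬ 2 ∣ a ℕ.+ b → 0ℚ ≡ diamond (indicator u) a b
    odd ¬even with even-or-odd (a ℕ.+ b)
    ... | inj₁ even = contradiction even ¬even
    ... | inj₂ 2∣1+a+b = sym (evenGrid-vanishes {diamond (indicator u)}
      (parity-left { - 1ℚ} {right (indicator u)}
        (parity-right {1ℚ} {indicator u} (indicator-even {u} black)))
      {a} {b} 2∣1+a+b)

  square : Fin (order (OD n)) → Vertex (OD n)
  square = lookup (vertices (OD n))

  square-black : ∀ i → Black (square i)
  square-black i = ∈-OD⁻ {n} (∈-lookup i)

  indicator-square : ∀ i j → indicator (square j) (toℕ (proj₁ (square i)))
    (toℕ (proj₂ (square i))) ≡ identity (order (OD n)) i j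
  indicator-square i j with i Fin.≟ j
  ... | yes refl = cong₂ _*_ (δ-refl (toℕ (proj₁ (square i)))) (δ-refl (toℕ (proj₂ (square i))))
  ... | no i≢j   = indicator-≢ {proj₁ (square j)} {proj₂ (square j)} (λ { (eq₁ , eq₂) →
    i≢j (sym (lookup-injective (unique (OD n))
      (cong₂ _,_ (toℕ-injective eq₁) (toℕ-injective eq₂)))) })

  Θ : Matrix (order Parts) (order (OD n))
  Θ i j = modes (indicator (square j)) (lookup (vertices Parts) i)

  -- A column of the adjacency matrix of `OD n` holds the coefficients of `diamond` of an indicator
  -- in terms of indicators. By linearity the left side is thus `modes` of that diamond, to which
  -- `modes-diamond` applies.
  Θ-intertwines : Θ · adjacencyMatrix (OD n) ≋ adjacencyMatrix Parts · Θ
  Θ-intertwines i j = begin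
    sum {k} (λ l → Θ i l * adjacencyMatrix (OD n) l j)
      ≡⟨ sum-cong-≗ {k} (λ l → ℚ.*-comm (Θ i l) (adjacencyMatrix (OD n) l j)) ⟩
    sum {k} (λ l → adjacencyMatrix (OD n) l j * Θ i l)
      ≡⟨ combination (linear-modes u) {k} (λ l → adjacencyMatrix (OD n) l j)
           (λ l → indicator (square l)) ⟨
    modes (λ a b → sum {k} (λ l → adjacencyMatrix (OD n) l j * indicator (square l) a b)) u
      ≡⟨ respects (linear-modes u) {λ a b → sum {k}
           (λ l → adjacencyMatrix (OD n) l j * indicator (square l) a b)}
           {diamond (indicator (square j))} (∑ˡ-entry-indicator {square j} (square-black j)) ⟩
    modes (diamond (indicator (square j))) u
      ≡⟨ modes-diamond {indicator (square j)} (indicator-even {square j} (square-black j)) u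
           (∈-lookup i) ⟩
    (adjacencyMatrix Parts · Θ) i j ∎
    where
    open ≡-Reasoning
    k : ℕ
    k = order (OD n)
    u : Vertex Parts
    u = lookup (vertices Parts) i

  -- A kernel vector lists the values of an even grid function on the black squares, and the
  -- vanishing of `Θ ·ᵥ x` says that all modes of this function are zero.
  Θ-injective : Injective Θ
  Θ-injective x Θx≡0 i = begin
    x i                                              ≡⟨ sum-identity x i ⟨
    sum {k} (λ j → identity k i j * x j)
      ≡⟨ sum-cong-≗ {k} (λ j → trans (ℚ.*-comm (identity k i j) (x j))
           (cong (x j *_) (sym (indicator-square i j)))) ⟩
    f (toℕ (proj₁ (square i))) (toℕ (proj₂ (square i)))
      ≡⟨ modes-determine {f} f-even modes≡0 (toℕ<n (proj₁ (square i)))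
           (toℕ<n (proj₂ (square i))) ⟩
    0ℚ ∎
    where
    open ≡-Reasoning
    k : ℕ
    k = order (OD n)
    f : Grid
    f a b = sum {k} (λ j → x j * indicator (square j) a b)
    f-even : HasParity 1ℚ f
    f-even = vanishing⇒even {f} (λ {a} {b} ¬even →
      sum-zero {k} (λ j → x j * indicator (square j) a b) (λ j → trans (cong (x j *_) (indicator-≢ {proj₁ (square j)} {proj₂ (square j)}
              (λ { (refl , refl) → ¬even (square-black j) })))
            (ℚ.*-zeroʳ (x j))))
    modes≡0 : ∀ u → u ∈ vertices Parts → modes f u ≡ 0ℚ
    modes≡0 u u∈ = begin
      modes f u  ≡⟨ cong (modes f) (lookup-index u∈) ⟩
      modes f (lookup (vertices Parts) (index u∈))
        ≡⟨ combination (linear-modes (lookup (vertices Parts) (index u∈))) {k} x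
             (λ j → indicator (square j)) ⟩
      sum {k} (λ j → x j * Θ (index u∈) j)
        ≡⟨ sum-cong-≗ {k} (λ j → ℚ.*-comm (x j) (Θ (index u∈) j)) ⟩
      (Θ ·ᵥ x) (index u∈)  ≡⟨ Θx≡0 (index u∈) ⟩
      0ℚ ∎

theorem3p3 : (n : ℕ) → n ≥ 1 →
    OD n ∼ HOD (n ∸ 1) ∪̇ HOD (n ∸ 1) ∪̇ P 1 ∪̇ Q n ∪̇ Q′ n
theorem3p3 (suc m) _ = orders-agree m ,
  injective-intertwiner⇒similar (orders-agree m) (adjacencyMatrix (OD (suc m)))
    (adjacencyMatrix Parts) Θ Θ-intertwines Θ-injective
  where open Modes m
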